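{- Let $m=rn$. There is a bijection between $\overline G_r(U,V;d)$ and the set of walks in $\widetilde W(d,2m;\vec 0)$ all of whose points lie in the region $\{x\in\mathbb Z^d: x_1\ge x_2\ge\cdots\ge x_d\}$.
   Context: Fix integers $n,r,d\ge1$, $m=rn$. $U=\{u_1\prec\cdots\prec u_n\}$, $V=\{v_1\prec\cdots\prec v_n\}$ are disjoint totally ordered sets. An $r$-regular bipartite multigraph on $(U,V)$ is a multiset of edges $uv$ in which every vertex has degree $r$. Edges $uv,u'v'$ are noncrossing if ($u\prec u'$ and $v\prec v'$) or ($u'\prec u$ and $v'\prec v$); a planar matching is a set of pairwise noncrossing edges; $L(G)$ is the maximum size of a planar matching; $G_r(U,V;d)$ is the set of $r$-regular multigraphs $G$ with $L(G)\le d$. Let $\overline U=U\times[r]$, $\overline V=V\times[r]$ (write $u^s$ for $(u,s)$), ordered lexicographically. An $r$-configuration is a bijection between $\overline U$ and $\overline V$. For $G$ an $r$-regular multigraph, its associated configuration $\overline G$: for each edge $uv$ of $G$ of multiplicity $t\ge1$, let $i$ be the number of edges $uv'$ of $G$ (with multiplicity) with $v\prec v'$, $j$ the number of edges $u'v$ with $u\prec u'$; $\overline G$ contains the pairs $(u^{i+s},v^{j+t-s+1})$, $s=1,\dots,t$. $\overline G_r(U,V;d)=\{\overline G:G\in G_r(U,V;d)\}$. Walks: $W^*(d,2m;P)$ is the set of walks in $\mathbb Z^d$ from the origin with steps $e_{a_1},\dots,e_{a_m},-e_{b_1},\dots,-e_{b_m}$ ($a_i,b_i\in[d]$) ending in $P$,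 written $a_1\cdots a_m|b_1\cdots b_m$; write $a_{u_i^s}=a_{r(i-1)+s}$, $b_{v_i^s}=b_{r(i-1)+s}$. $W'(d,2m;P)$ is the set of such walks with $a_{u^s}\ge a_{u^{s+1}}$ and $b_{v^s}\ge b_{v^{s+1}}$ for all $u\in U,v\in V$, $1\le s<r$. For $w=a_1\cdots a_m|b_1\cdots b_m\in W'(d,2m;\vec 0)$ let $\tilde w=a_1\cdots a_m|b_m b_{m-1}\cdots b_1$ (the negative steps taken in reverse order), and $\widetilde W(d,2m;\vec 0)=\{\tilde w: w\in W'(d,2m;\vec 0)\}$. A walk stays in a region if all its visited lattice points (including start and end) lie in it. -}

module Defs where

open import Algebra.Properties.CommutativeMonoid.Sum using (sum)
open import Data.Bool.Base using (if_then_else_)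
open import Data.Fin.Base as Fin using (Fin; toℕ; combine)
open import Data.Fin.Properties as Fin using (_≟_)
open import Data.Integer.Base as ℤ using (ℤ; 0ℤ; 1ℤ)
open import Data.List.Base using (List; length; map; foldl; _++_)
open import Data.List.Relation.Unary.All using (All)
open import Data.List.Relation.Unary.AllPairs using (AllPairs)
open import Data.List.Scans.Base using (scanl)
open import Data.Nat.Base using (ℕ; suc; _+_; _*_; _∸_; _≤_)
open import Data.Nat.Properties using (+-0-commutativeMonoid)
open import Data.Product.Base using (Σ; ∃-syntax; _×_; _,_; proj₁)
open import Data.Sum.Base using (_⊎_)
open import Data.Vec.Base as Vec using (Vec; lookup)
open import Function.Bundles using (_⤖_; _⇔_; Bijection)
open import Level using (0ℓ)
open import Relation.Binary.Bundles using (Setoid)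
open import Relation.Binary.Construct.On as On using ()
open import Relation.Binary.PropositionalEquality.Core
  using (_≡_; refl; sym; trans)
open import Relation.Binary.PropositionalEquality.Properties
  using () renaming (setoid to ≡-setoid)
open import Relation.Nullary.Decidable.Core using (⌊_⌋)
open import Relation.Unary using (Pred)

subsetoid : (S : Setoid 0ℓ 0ℓ) → Pred (Setoid.Carrier S) 0ℓ → Setoid 0ℓ 0ℓ
subsetoid S P = On.setoid {B = Σ (Setoid.Carrier S) P} S proj₁

Σᶠ : ∀ {n} → (Fin n → ℕ) → ℕ
Σᶠ = sum +-0-commutativeMonoid

-- U and V are two copies of Fin n, each with its usual order; the first
-- component of a pair (edge) is always the U-end, the second the V-end.
-- A bipartite multigraph on (U , V) is given by its edge multiplicities.
Multigraph : ℕ → Set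
Multigraph n = Fin n → Fin n → ℕ

Regular : ∀ {n} → ℕ → Multigraph n → Set
Regular r G = (∀ u → Σᶠ (λ v → G u v) ≡ r) × (∀ v → Σᶠ (λ u → G u v) ≡ r)

Noncrossing : ∀ {n} → (e e′ : Fin n × Fin n) → Set
Noncrossing (u , v) (u′ , v′) =
  (u Fin.< u′ × v Fin.< v′) ⊎ (u′ Fin.< u × v′ Fin.< v)

-- A list may stand for a set here: noncrossing is symmetric and irreflexive,
-- so the entries are distinct and their order is immaterial.
PlanarMatching : ∀ {n} → Multigraph n → Pred (List (Fin n × Fin n)) 0ℓ
PlanarMatching G es = All (λ (u , v) → 1 ≤ G u v) es × AllPairs Noncrossing es

-- L(G) = ℓ
MaxPlanarMatching : ∀ {n} → Multigraph n → ℕ → Set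
MaxPlanarMatching G ℓ =
  (∃[ es ] PlanarMatching G es × length es ≡ ℓ) ×
  (∀ es → PlanarMatching G es → length es ≤ ℓ)

𝒢 : ∀ {n} (r d : ℕ) → Pred (Multigraph n) 0ℓ
𝒢 r d G = Regular r G × ∃[ ℓ ] MaxPlanarMatching G ℓ × ℓ ≤ d

-- Superscripts range over Fin r instead of {1,…,r}: k : Fin r
-- stands for the superscript suc (toℕ k).
Configuration : (n r : ℕ) → Set
Configuration n r = (Fin n × Fin r) ⤖ (Fin n × Fin r)

ConfigurationSetoid : (n r : ℕ) → Setoid 0ℓ 0ℓ
ConfigurationSetoid n r = record
  { Carrier       = Configuration n r
  ; _≈_           = λ c c′ → ∀ x → Bijection.to c x ≡ Bijection.to c′ x
  ; isEquivalence = record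
    { refl  = λ _ → refl
    ; sym   = λ p x → sym (p x)
    ; trans = λ p q x → trans (p x) (q x)
    }
  }

edgesAfterV : ∀ {n} → Multigraph n → Fin n → Fin n → ℕ
edgesAfterV G u v = Σᶠ (λ v′ → if ⌊ v Fin.<? v′ ⌋ then G u v′ else 0)

edgesAfterU : ∀ {n} → Multigraph n → Fin n → Fin n → ℕ
edgesAfterU G u v = Σᶠ (λ u′ → if ⌊ u Fin.<? u′ ⌋ then G u′ v else 0)

-- The set of pairs (uⁱ⁺ˢ , vʲ⁺ᵗ⁻ˢ⁺¹), 1 ≤ s ≤ t, over all edges uv of G.
AssociatedPair : ∀ {n r} → Multigraph n → (x y : Fin n × Fin r) → Set
AssociatedPair G (u , k) (v , l) =
  let t = G u v
      i = edgesAfterV G u v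
      j = edgesAfterU G u v
  in ∃[ s ] 1 ≤ s × s ≤ t ×
       suc (toℕ k) ≡ i + s × suc (toℕ l) ≡ j + (t ∸ s) + 1

-- c = G̅, as sets of pairs.
IsAssociated : ∀ {n r} → Multigraph n → Configuration n r → Set
IsAssociated G c = ∀ x y → Bijection.to c x ≡ y ⇔ AssociatedPair G x y

𝒢̅ : (n r d : ℕ) → Setoid 0ℓ 0ℓ
𝒢̅ n r d = subsetoid (ConfigurationSetoid n r)
  (λ c → ∃[ G ] 𝒢 r d G × IsAssociated G c)

Point : ℕ → Set
Point d = Fin d → ℤ

origin : ∀ {d} → Point d
origin _ = 0ℤ

data Step (d : ℕ) : Set where
  +e -e : Fin d → Step d

unit : ∀ {d} → Fin d → Point d
unit a i = if ⌊ a ≟ i ⌋ then 1ℤ else 0ℤ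

move : ∀ {d} → Point d → Step d → Point d
move x (+e a) i = x i ℤ.+ unit a i
move x (-e b) i = x i ℤ.- unit b i

-- The word a₁⋯aₘ|b₁⋯bₘ; the walk starts at the origin.
record Walk (d m : ℕ) : Set where
  constructor _∣_
  field
    a : Vec (Fin d) m
    b : Vec (Fin d) m

steps : ∀ {d m} → Walk d m → List (Step d)
steps (a ∣ b) = map +e (Vec.toList a) ++ map -e (Vec.toList b)

endpoint : ∀ {d m} → Walk d m → Point d
endpoint w = foldl move origin (steps w)

visited : ∀ {d m} → Walk d m → List (Point d)
visited w = scanl move origin (steps w)

W* : (d m : ℕ) → Point d → Pred (Walk d m) 0ℓ
W* d m P w = ∀ i → endpoint w i ≡ P i

-- combine u s is the 0-based position r·u + s.
BlockDecreasing : ∀ {d} n r → Pred (Vec (Fin d) (n * r)) 0ℓ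
BlockDecreasing n r a = ∀ (u : Fin n) (s s′ : Fin r) → toℕ s′ ≡ suc (toℕ s) →
  lookup a (combine u s′) Fin.≤ lookup a (combine u s)

W′ : (d n r : ℕ) → Point d → Pred (Walk d (n * r)) 0ℓ
W′ d n r P w =
  W* d (n * r) P w × BlockDecreasing n r (Walk.a w) × BlockDecreasing n r (Walk.b w)

tilde : ∀ {d m} → Walk d m → Walk d m
tilde (a ∣ b) = a ∣ Vec.reverse b

W̃ : (d n r : ℕ) → Pred (Walk d (n * r)) 0ℓ
W̃ d n r x = ∃[ w ] W′ d n r origin w × x ≡ tilde w

Region : ∀ d → Pred (Point d) 0ℓ
Region d x = ∀ (i i′ : Fin d) → toℕ i′ ≡ suc (toℕ i) → x i′ ℤ.≤ x i

StaysIn : ∀ {d m} → Pred (Point d) 0ℓ → Pred (Walk d m) 0ℓ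
StaysIn R w = All R (visited w)

W̃-inRegion : (n r d : ℕ) → Setoid 0ℓ 0ℓ
W̃-inRegion n r d = subsetoid (≡-setoid (Walk d (n * r)))
  (λ x → W̃ d n r x × StaysIn (Region d) x)

{-# OPTIONS --safe #-}

-- Read a configuration as a permutation σ of {0,…,rn-1}.  It comes from a regular multigraph iff
-- σ and σ⁻¹ decrease inside every block of length r, and then a planar matching is the same as an
-- increasing subsequence of σ, since two of its points never share a block.  The Robinson–Schensted
-- correspondence, in the form of Fomin's growth diagrams, sends σ to two standard tableaux of the
-- same shape.  The length of the first row of the shape is the longest increasing subsequence, so
-- L(G) ≤ d says that there are at most d columns; descents of σ (of σ⁻¹) are descents of the
-- recording (insertion) tableau.  Listing the columns of the boxes 1, 2, … of both tableaux gives
-- the words a and b: partition shapes mean that the walk and its reversed return stay in the region,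
-- the common shape means that the walk closes up, and descents are weak descents of a and b.
module Submission where

open import Defs
import Algebra.Properties.CommutativeMonoid.Sum as Sum
open import Data.Bool.Base using (Bool; true; false; if_then_else_)
open import Data.Fin.Base as Fin using (Fin; toℕ; fromℕ<; combine; remQuot)
open import Data.Fin.Properties as Fin
  using (toℕ-injective; toℕ<n; toℕ-fromℕ<; fromℕ<-injective; injective⇒≤; toℕ-combine;
         combine-monoˡ-<; combine-remQuot; combine-injective)
open import Data.Integer.Base as ℤ using (0ℤ; +≤+)
import Data.Integer.Properties as ℤ
open import Data.List.Base as List using (List; []; _∷_; length; map; foldl; _++_)
open import Data.List.Membership.Propositional.Properties using (∈-lookup)
open import Data.List.Properties using (length-map; unfold-reverse; map-++; foldl-++)
open import Data.List.Relation.Unary.All as All using (All; []; _∷_)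
import Data.List.Relation.Unary.All.Properties as All
open import Data.List.Relation.Unary.AllPairs as AllPairs using (AllPairs; []; _∷_)
import Data.List.Relation.Unary.AllPairs.Properties as AllPairs
open import Data.List.Scans.Base using (scanl)
open import Data.Nat.Base
open import Data.Nat.Properties
open import Data.Product.Base using (∃-syntax; Σ-syntax; _×_; _,_; proj₁; proj₂; uncurry)
open import Data.Product.Properties using (≡-dec; ×-≡,≡→≡; ,-injectiveˡ; ,-injectiveʳ)
open import Data.Sum.Base using (_⊎_; inj₁; inj₂)
open import Data.Vec.Base using (Vec; []; _∷_; lookup; toList)
open import Data.Vec.Properties using (toList-reverse; reverse-injective)
open import Function.Base using (_∘_; flip; _on_)
open import Function.Bundles using (_⇔_; mk⇔; Equivalence; _↔_; Inverse; mk↔ₛ′; Bijection)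
open import Function.Properties.Bijection using (⤖⇒↔)
open import Function.Properties.Inverse using (↔⇒⤖)
open import Relation.Binary.Bundles using (Setoid)
open import Relation.Binary.Definitions using (tri<; tri≈; tri>)
open import Relation.Binary.PropositionalEquality
open import Relation.Nullary using (¬_; Dec; yes; no; contradiction)
open import Relation.Nullary.Decidable.Core using (⌊_⌋)
open Sum +-0-commutativeMonoid using (sum-cong-≗; ∑-comm; ∑-distrib-+; sum-replicate-zero)

-- Lattice words and conjugation

-- The edges of the diagram carry rows of boxes instead of shapes at the corners. The local rules
-- are then four patterns of numbers, a shape is a count of labels along a path, and everything
-- about shapes becomes an invariant carried from cell to cell. The walk wants columns instead: its
-- coordinate i is the height of column i, so a bound on the number of columns bounds the dimension.
-- Hence the words are transposed at both ends, and a strict increase of rows turns into a weak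
-- decrease of columns. The delicate direction is backwards: from two words of equal content the
-- rules can be run down to the left and bottom borders, but nothing says yet that these borders are
-- empty. This is won by carrying removable corners from right to left, one row of cells at a time.
-- A permutation thus meets two diagrams, one built forwards and one built backwards; uniqueness of
-- labels makes them interchangeable. Words and permutations are functions on all of ℕ whose values
-- below `m` alone have a meaning, so equalities are stated below `m`.

δ : ℕ → ℕ → ℕ
δ zero    zero    = 1
δ zero    (suc _) = 0
δ (suc _) zero    = 0
δ (suc a) (suc b) = δ a b

δ-refl : ∀ a → δ a a ≡ 1
δ-refl zero    = refl
δ-refl (suc a) = δ-refl a

δ-≢ : ∀ {a b} → a ≢ b → δ a b ≡ 0
δ-≢ {zero}  {zero}  a≢b = contradiction refl a≢b
δ-≢ {zero}  {suc _} _   = refl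
δ-≢ {suc _} {zero}  _   = refl
δ-≢ {suc _} {suc _} a≢b = δ-≢ (a≢b ∘ cong suc)

count : (ℕ → ℕ) → ℕ → ℕ → ℕ
count w zero    c = 0
count w (suc k) c = count w k c + δ (w k) c

count-hit : ∀ w k {c} → w k ≡ c → count w (suc k) c ≡ suc (count w k c)
count-hit w k refl = trans (cong (count w k (w k) +_) (δ-refl (w k))) (+-comm _ 1)

count-miss : ∀ w k {c} → w k ≢ c → count w (suc k) c ≡ count w k c
count-miss w k wk≢c = trans (cong (count w k _ +_) (δ-≢ wk≢c)) (+-identityʳ _)

count-cong : ∀ {w w′} k {c} → (∀ {i} → i < k → w i ≡ w′ i) → count w k c ≡ count w′ k c
count-cong zero    _  = refl
count-cong (suc k) eq = cong₂ _+_ (count-cong k (eq ∘ m<n⇒m<1+n)) (cong (λ a → δ a _) (eq ≤-refl))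

count-step-≤ : ∀ w k c → count w k c ≤ count w (suc k) c
count-step-≤ w k c = m≤m+n _ _

count-mono : ∀ w {k l} c → k ≤ l → count w k c ≤ count w l c
count-mono w c z≤n = z≤n
count-mono w {suc k} {suc l} c k≤l with m≤n⇒m<n∨m≡n k≤l
... | inj₁ (s≤s k<l) = ≤-trans (count-mono w c k<l) (count-step-≤ w l c)
... | inj₂ refl      = ≤-refl

count-absent : ∀ w k {c i} → count w k c ≡ 0 → i < k → w i ≢ c
count-absent w k {c} {i} none i<k wi≡c = contradiction
  (≤-trans (≤-reflexive (sym (count-hit w i wi≡c))) (≤-trans (count-mono w c i<k) (≤-reflexive none)))
  λ ()

count-zero : ∀ w k c → (∀ {i} → i < k → w i ≢ c) → count w k c ≡ 0
count-zero w zero    c _  = refl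
count-zero w (suc k) c ≢c = trans (count-miss w k (≢c ≤-refl)) (count-zero w k c (≢c ∘ m<n⇒m<1+n))

Partition : (ℕ → ℕ) → Set
Partition x = ∀ c → x (suc c) ≤ x c

-- These are the Yamanouchi words, in bijection with standard Young tableaux: letter number k is the
-- row that receives the next box.
Lattice : ℕ → (ℕ → ℕ) → Set
Lattice m w = ∀ {k} → k ≤ m → Partition (count w k)

partition-mono : ∀ {x} → Partition x → ∀ {c e} → c ≤ e → x e ≤ x c
partition-mono part {c} {e} c≤e with m≤n⇒m<n∨m≡n c≤e
partition-mono part {c} {suc e} _ | inj₁ (s≤s c≤e) = ≤-trans (part e) (partition-mono part c≤e)
... | inj₂ refl = ≤-refl

-- The k-th letter is the row of the k-th box of a growing Young diagram;
-- the transposed word lists the columns of these boxes.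
transpose : (ℕ → ℕ) → ℕ → ℕ
transpose w k = count w k (w k)

transpose-cong : ∀ {m w w′} → (∀ {i} → i < m → w i ≡ w′ i) → ∀ {k} → k < m → transpose w k ≡ transpose w′ k
transpose-cong {w = w} {w′} eq {k} k<m =
  trans (cong (count w k) (eq k<m)) (count-cong k (λ i<k → eq (<-trans i<k k<m)))

-- Row lengths `x` and column lengths `y` of one set of boxes, where (r , c) is a box. Phrased by
-- membership of boxes, so that uniqueness and the partition property of `y` follow by comparing
-- initial segments.
Conjugate : (x y : ℕ → ℕ) → Set
Conjugate x y = ∀ r c → (c < x r → r < y c) × (r < y c → c < x r)

<-ext : ∀ {a b} → (∀ r → r < a → r < b) → a ≤ b
<-ext {a} {b} f = ≮⇒≥ λ b<a → <-irrefl refl (f b b<a)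

conjugate-≤ : ∀ {x x′ y y′} → Conjugate x y → Conjugate x′ y′ → (∀ r → x r ≤ x′ r) → ∀ c → y c ≤ y′ c
conjugate-≤ conj conj′ x≤x′ c = <-ext λ r r<y → proj₁ (conj′ r c) (≤-trans (proj₂ (conj r c) r<y) (x≤x′ r))

conjugate-unique : ∀ {x x′ y y′} → Conjugate x y → Conjugate x′ y′ → (∀ r → x r ≡ x′ r) → ∀ c → y c ≡ y′ c
conjugate-unique conj conj′ eq c = ≤-antisym
  (conjugate-≤ conj conj′ (≤-reflexive ∘ eq) c) (conjugate-≤ conj′ conj (≤-reflexive ∘ sym ∘ eq) c)

conjugate-partition : ∀ {x y} → Conjugate x y → Partition y
conjugate-partition conj c = <-ext λ r r<y → proj₁ (conj r c) (<-trans (n<1+n c) (proj₂ (conj r (suc c)) r<y))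

-- The box of step k is about to enter column `transpose w k`, which row `w k` has not reached yet;
-- this bounds the column from above. After the step every higher row is at least as long as row
-- `w k`, so those rows already occupy the column.
corner : ∀ {m w k} → Lattice m w → k < m → ∀ {y} → Conjugate (count w k) y → y (transpose w k) ≡ w k
corner {m} {w} {k} lat k<m {y} conj = ≤-antisym
  (≮⇒≥ λ wk<y → <-irrefl refl (proj₂ (conj (w k) (transpose w k)) wk<y))
  (<-ext below)
  where
  below : ∀ r → r < w k → r < y (transpose w k)
  below r r<wk = proj₁ (conj r (transpose w k)) (begin-strict
    count w k (w k)       <⟨ n<1+n _ ⟩
    suc (count w k (w k)) ≡⟨ count-hit w k refl ⟨
    count w (suc k) (w k) ≤⟨ partition-mono (lat k<m) (<⇒≤ r<wk) ⟩
    count w (suc k) r     ≡⟨ count-miss w k (≢-sym (<⇒≢ r<wk)) ⟩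
    count w k r           ∎)
    where open ≤-Reasoning

-- Each step adds one box, to row `w k` on one side and to column `transpose w k` on the other. By
-- `corner` the old height of that column is `w k`, so both sides gain the same box.
transpose-conjugate : ∀ {m w} → Lattice m w → ∀ {k} → k ≤ m → Conjugate (count w k) (count (transpose w) k)
transpose-conjugate lat {zero} _ r c = (λ ()) , (λ ())
transpose-conjugate {m} {w} lat {suc k} k<m r c = go (w k ≟ r) (transpose w k ≟ c)
  where
  IH = transpose-conjugate lat (<⇒≤ k<m)
  w′ = transpose w

  row : w k ≡ count w′ k (w′ k)
  row = sym (corner lat k<m IH)

  strict : ∀ {a b} → a ≢ b → a < suc b → a < b
  strict a≢b (s≤s a≤b) = ≤∧≢⇒< a≤b a≢b

  go : Dec (w k ≡ r) → Dec (w′ k ≡ c) →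
       (c < count w (suc k) r → r < count w′ (suc k) c) × (r < count w′ (suc k) c → c < count w (suc k) r)
  go (yes refl) (yes refl) =
    (λ _ → subst₂ _<_ refl (sym (count-hit w′ k refl)) (s≤s (≤-reflexive row))) ,
    (λ _ → subst₂ _<_ refl (sym (count-hit w k refl)) ≤-refl)
  go (yes refl) (no ≢c) =
    (λ lt → subst₂ _<_ refl (sym (count-miss w′ k ≢c))
              (proj₁ (IH _ _) (strict (≢-sym ≢c) (subst₂ _<_ refl (count-hit w k refl) lt)))) ,
    (λ lt → subst₂ _<_ refl (sym (count-hit w k refl))
              (m<n⇒m<1+n (proj₂ (IH _ _) (subst₂ _<_ refl (count-miss w′ k ≢c) lt))))
  go (no ≢r) (yes refl) =
    (λ lt → subst₂ _<_ refl (sym (count-hit w′ k refl))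
              (m<n⇒m<1+n (proj₁ (IH _ _) (subst₂ _<_ refl (count-miss w k ≢r) lt)))) ,
    (λ lt → subst₂ _<_ refl (sym (count-miss w k ≢r))
              (proj₂ (IH _ _) (strict (λ eq → ≢r (trans row (sym eq))) (subst₂ _<_ refl (count-hit w′ k refl) lt))))
  go (no ≢r) (no ≢c) =
    (λ lt → subst₂ _<_ refl (sym (count-miss w′ k ≢c)) (proj₁ (IH _ _) (subst₂ _<_ refl (count-miss w k ≢r) lt))) ,
    (λ lt → subst₂ _<_ refl (sym (count-miss w k ≢r)) (proj₂ (IH _ _) (subst₂ _<_ refl (count-miss w′ k ≢c) lt)))

transpose-lattice : ∀ {m w} → Lattice m w → Lattice m (transpose w)
transpose-lattice lat k≤m = conjugate-partition (transpose-conjugate lat k≤m)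

transpose-involutive : ∀ {m w} → Lattice m w → ∀ {k} → k < m → transpose (transpose w) k ≡ w k
transpose-involutive lat k<m = corner lat k<m (transpose-conjugate lat (<⇒≤ k<m))

transpose-count-cong : ∀ {m w w′} → Lattice m w → Lattice m w′ →
  (∀ c → count w m c ≡ count w′ m c) → ∀ c → count (transpose w) m c ≡ count (transpose w′) m c
transpose-count-cong lat lat′ =
  conjugate-unique (transpose-conjugate lat ≤-refl) (transpose-conjugate lat′ ≤-refl)

-- After both steps each of the two rows ends in its new box, and a lower row is no longer than a
-- higher one.
transpose-descent : ∀ {m w k} → Lattice m w → suc k < m → w k < w (suc k) → transpose w (suc k) ≤ transpose w k
transpose-descent {m} {w} {k} lat k<m wk<w = s≤s⁻¹ (begin
  suc (count w (suc k) (w (suc k)))   ≡⟨ count-hit w (suc k) refl ⟨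
  count w (suc (suc k)) (w (suc k))   ≤⟨ partition-mono (lat k<m) (<⇒≤ wk<w) ⟩
  count w (suc (suc k)) (w k)         ≡⟨ count-miss w (suc k) (≢-sym (<⇒≢ wk<w)) ⟩
  count w (suc k) (w k)               ≡⟨ count-hit w k refl ⟩
  suc (count w k (w k))               ∎)
  where open ≤-Reasoning

-- The row of the second box is no lower, so it already reaches past the first box when the second
-- is placed.
transpose-ascent : ∀ {m w k} → Lattice m w → suc k < m → w (suc k) ≤ w k → transpose w k < transpose w (suc k)
transpose-ascent {m} {w} {k} lat k<m w≤wk = begin-strict
  count w k (w k)             <⟨ n<1+n _ ⟩
  suc (count w k (w k))       ≡⟨ count-hit w k refl ⟨
  count w (suc k) (w k)       ≤⟨ partition-mono (lat (<⇒≤ k<m)) w≤wk ⟩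
  count w (suc k) (w (suc k)) ∎
  where open ≤-Reasoning

transpose-bound : ∀ {m w d} → Lattice m w → count w m 0 ≤ d → ∀ {k} → k < m → transpose w k < d
transpose-bound {m} {w} {d} lat ≤d {k} k<m = begin-strict
  count w k (w k)       <⟨ n<1+n _ ⟩
  suc (count w k (w k)) ≡⟨ count-hit w k refl ⟨
  count w (suc k) (w k) ≤⟨ partition-mono (lat k<m) z≤n ⟩
  count w (suc k) 0     ≤⟨ count-mono w 0 k<m ⟩
  count w m 0           ≤⟨ ≤d ⟩
  d                     ∎
  where open ≤-Reasoning

-- A first row of the transposed shape longer than `d` would force the letter `d` to occur in `w`.
transpose-width : ∀ {m w d} → Lattice m w → (∀ {k} → k < m → w k < d) → count (transpose w) m 0 ≤ d
transpose-width {m} {w} {d} lat <d = ≮⇒≥ λ d<y →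
  contradiction (proj₂ (transpose-conjugate lat ≤-refl d 0) d<y)
    (subst (λ x → ¬ 0 < x) (sym (count-zero w m d (λ i<m → <⇒≢ (<d i<m)))) λ ())

-- Growth diagrams

-- A cell of Fomin's growth diagram with its bottom, left, top and right labels.  A positive
-- label is the row of the box in which the shapes at the two ends of the edge differ;
-- 0 means that they agree.
data Cell : (p h p′ h′ : ℕ) → Set where
  empty : Cell 0 0 0 0
  mark  : Cell 0 0 1 1
  bump  : ∀ c → Cell (suc c) (suc c) (suc (suc c)) (suc (suc c))
  pass  : ∀ {p h} → p ≢ h → Cell p h p h

cell-swap : ∀ {p h p′ h′} → Cell p h p′ h′ → Cell h p h′ p′
cell-swap empty      = empty
cell-swap mark       = mark
cell-swap (bump c)   = bump c
cell-swap (pass p≢h) = pass (≢-sym p≢h)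

-- Conservation law: the path left-then-top across the cell adds the same boxes as the path
-- bottom-then-right. It is the reason that shapes do not depend on the path.
cell-δ : ∀ {p h p′ h′} → Cell p h p′ h′ → ∀ c → δ p′ c + δ h c ≡ δ p c + δ h′ c
cell-δ empty    c = refl
cell-δ mark     c = +-comm (δ 1 c) (δ 0 c)
cell-δ (bump e) c = +-comm (δ (2 + e) c) (δ (1 + e) c)
cell-δ (pass _) c = refl

cell-positive : ∀ {p h p′ h′} → Cell p h p′ h′ → p ≢ 0 → p′ ≢ 0
cell-positive empty    p≢0 = p≢0
cell-positive mark     p≢0 = λ ()
cell-positive (bump _) p≢0 = λ ()
cell-positive (pass _) p≢0 = p≢0

cell-switch : ∀ {p h p′ h′} → Cell p h p′ h′ → p ≡ 0 → p′ ≢ 0 → h ≡ 0 × p′ ≡ 1 × h′ ≡ 1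
cell-switch empty    p≡0 p′≢0 = contradiction refl p′≢0
cell-switch mark     p≡0 p′≢0 = refl , refl , refl
cell-switch (pass _) p≡0 p′≢0 = contradiction p≡0 p′≢0

cell-ones : ∀ {p h} → Cell p h 1 1 → p ≡ 0 × h ≡ 0
cell-ones mark       = refl , refl
cell-ones (pass 1≢1) = contradiction refl 1≢1

-- The incoming labels leave a single choice, between `empty` and `mark` when both are 0. Knowing
-- whether the top label vanishes settles it.
cell-forward-unique : ∀ {p h p₁ h₁ p₂ h₂} → Cell p h p₁ h₁ → Cell p h p₂ h₂ →
  (p₁ ≡ 0 → p₂ ≡ 0) → (p₂ ≡ 0 → p₁ ≡ 0) → p₁ ≡ p₂ × h₁ ≡ h₂
cell-forward-unique empty      empty      f g = refl , refl
cell-forward-unique empty      mark       f g = contradiction (f refl) λ ()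
cell-forward-unique empty      (pass 0≢0) f g = contradiction refl 0≢0
cell-forward-unique mark       empty      f g = contradiction (g refl) λ ()
cell-forward-unique mark       mark       f g = refl , refl
cell-forward-unique mark       (pass 0≢0) f g = contradiction refl 0≢0
cell-forward-unique (bump c)   (bump c)   f g = refl , refl
cell-forward-unique (bump c)   (pass c≢c) f g = contradiction refl c≢c
cell-forward-unique (pass 0≢0) empty      f g = contradiction refl 0≢0
cell-forward-unique (pass 0≢0) mark       f g = contradiction refl 0≢0
cell-forward-unique (pass c≢c) (bump c)   f g = contradiction refl c≢c
cell-forward-unique (pass _)   (pass _)   f g = refl , refl

-- Backwards there is no choice: outgoing labels 0, 0 come from `empty` and 1, 1 from `mark`. So
-- marks can be recovered from labels alone.
cell-backward-unique : ∀ {p₁ h₁ p₂ h₂ p′ h′} → Cell p₁ h₁ p′ h′ → Cell p₂ h₂ p′ h′ → p₁ ≡ p₂ × h₁ ≡ h₂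
cell-backward-unique empty      empty      = refl , refl
cell-backward-unique empty      (pass 0≢0) = contradiction refl 0≢0
cell-backward-unique mark       mark       = refl , refl
cell-backward-unique mark       (pass 1≢1) = contradiction refl 1≢1
cell-backward-unique (bump c)   (bump c)   = refl , refl
cell-backward-unique (bump c)   (pass c≢c) = contradiction refl c≢c
cell-backward-unique (pass 0≢0) empty      = contradiction refl 0≢0
cell-backward-unique (pass 1≢1) mark       = contradiction refl 1≢1
cell-backward-unique (pass c≢c) (bump c)   = contradiction refl c≢c
cell-backward-unique (pass _)   (pass _)   = refl , refl

-- Labels exceed row numbers by one, so the label 0 adds no box.
add : (ℕ → ℕ) → ℕ → ℕ → ℕ
add x a c = x c + δ a (suc c)

add-hit : ∀ x c → add x (suc c) c ≡ suc (x c)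
add-hit x c = trans (cong (x c +_) (δ-refl c)) (+-comm _ 1)

add-miss : ∀ x {a c} → a ≢ suc c → add x a c ≡ x c
add-miss x a≢c = trans (cong (x _ +_) (δ-≢ a≢c)) (+-identityʳ _)

-- The labels 0 and 1 are unconstrained: adding nothing and extending row 0 are always allowed.
Addable : ℕ → (ℕ → ℕ) → Set
Addable h x = ∀ c → h ≡ suc (suc c) → x (suc c) < x c

-- The row named by a positive label ends in a removable box.
Corner : ℕ → (ℕ → ℕ) → Set
Corner h x = ∀ c → h ≡ suc c → x (suc c) < x c

partition-cong : ∀ {x y} → (∀ c → x c ≡ y c) → Partition x → Partition y
partition-cong eq part c = subst₂ _≤_ (eq (suc c)) (eq c) (part c)

corner-cong : ∀ {x y h} → (∀ c → x c ≡ y c) → Corner h x → Corner h y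
corner-cong eq cor c h≡c = subst₂ _<_ (eq (suc c)) (eq c) (cor c h≡c)

add-partition : ∀ {x h} → Partition x → Addable h x → Partition (add x h)
add-partition {x} {h} part addable c with h ≟ suc (suc c)
... | yes refl = ≤-trans (≤-reflexive (add-hit x (suc c))) (≤-trans (addable c refl) (m≤m+n _ _))
... | no ≢c    = ≤-trans (≤-reflexive (add-miss x ≢c)) (≤-trans (part c) (m≤m+n _ _))

add-corner : ∀ {x a} → Partition x → Partition (add x (suc a)) → Corner (suc a) (add x (suc a))
add-corner {x} {a} part part′ .a refl =
  ≤-trans (s≤s (≤-trans (≤-reflexive (add-miss x {suc a} (≢-sym 1+n≢n))) (part a)))
          (≤-reflexive (sym (add-hit x a)))

remove-partition : ∀ {x h} → Partition (add x h) → Corner h (add x h) → Partition x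
remove-partition {x} {h} part cor c with h ≟ suc c
... | yes refl = s≤s⁻¹ (≤-trans (s≤s (m≤m+n _ _)) (≤-trans (cor c refl) (≤-reflexive (add-hit x c))))
... | no ≢c    = ≤-trans (m≤m+n _ _) (≤-trans (part c) (≤-reflexive (add-miss x ≢c)))

-- One cell to the right, `x` being the lower left shape. A bump has just lengthened the row above
-- the new target; in a pass the target row is untouched because the labels differ.
addable-step : ∀ {p h p′ h′ x} → Cell p h p′ h′ → Partition x → Addable h x → Addable h′ (add x p)
addable-step {x = x} (bump _) part _ c refl =
  ≤-trans (s≤s (≤-trans (≤-reflexive (add-miss x {suc c} (≢-sym 1+n≢n))) (part c)))
          (≤-reflexive (sym (add-hit x c)))
addable-step {x = x} (pass p≢h) part addable c refl =
  ≤-trans (s≤s (≤-reflexive (add-miss x p≢h))) (≤-trans (addable c refl) (m≤m+n _ _))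

-- One cell to the left along the top edge, `x` being the upper left shape. After a bump the top
-- label puts a box into the next row, and the partition condition says that the row above it was
-- longer.
corner-step : ∀ {p h p′ h′ x} → Cell p h p′ h′ → Partition (add x p′) → Corner h′ (add x p′) → Corner h x
corner-step {x = x} (bump _) part cor c refl =
  ≤-trans (≤-reflexive (sym (add-hit x (suc c))))
          (≤-trans (part c) (≤-reflexive (add-miss x 1+n≢n)))
corner-step {x = x} (pass p≢h) part cor c refl =
  ≤-trans (s≤s (m≤m+n _ _)) (≤-trans (cor c refl) (≤-reflexive (add-miss x p≢h)))

-- p i j and h i j label the bottom and the left edge of the cell (i , j), and shape j i is the
-- Young diagram at its lower left corner, with rows numbered from 0.
record Grid (m : ℕ) : Set where
  field
    p h  : ℕ → ℕ → ℕ
    cell : ∀ {i j} → i < m → j < m → Cell (p i j) (h i j) (p i (suc j)) (h (suc i) j)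

  shape : ℕ → ℕ → ℕ → ℕ
  shape j i c = count (λ i′ → p i′ j) i (suc c)

  -- `cell-δ` summed along a row of cells. The premise on `h 0 j` says that the left border
  -- contributes no box.
  conserve : ∀ {i j} → i ≤ m → j < m → (∀ c → δ (h 0 j) (suc c) ≡ 0) →
             ∀ c → shape (suc j) i c ≡ add (shape j i) (h i j) c
  conserve {zero}  {j} _   j<m h0 c = sym (h0 c)
  conserve {suc i} {j} i<m j<m h0 c = begin
    shape (suc j) i c + p′           ≡⟨ cong (_+ p′) (conserve (<⇒≤ i<m) j<m h0 c) ⟩
    shape j i c + δh + p′            ≡⟨ +-assoc (shape j i c) δh p′ ⟩
    shape j i c + (δh + p′)          ≡⟨ cong (shape j i c +_) (trans (+-comm δh p′) (cell-δ (cell i<m j<m) (suc c))) ⟩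
    shape j i c + (δp + h′)          ≡⟨ +-assoc (shape j i c) δp h′ ⟨
    shape j i c + δp + h′            ∎
    where
    open ≡-Reasoning
    p′ = δ (p i (suc j)) (suc c)
    δh = δ (h i j) (suc c)
    δp = δ (p i j) (suc c)
    h′ = δ (h (suc i) j) (suc c)

swap : ∀ {m} → Grid m → Grid m
swap g = record { p = flip h ; h = flip p ; cell = λ i<m j<m → cell-swap (cell j<m i<m) }
  where open Grid g

downward : ∀ (P : ℕ → Set) {m} → P m → (∀ {j} → j < m → P (suc j) → P j) → ∀ {j} → j ≤ m → P j
downward P {m} base step {j} j≤m with m≤n⇒m<n∨m≡n j≤m
downward P {suc m} base step {j} j≤m | inj₁ (s≤s j≤m′) =
  downward P (step ≤-refl base) (λ j<m → step (m<n⇒m<1+n j<m)) j≤m′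
... | inj₂ refl = base

-- Two nested downward inductions: rows of cells from the top, and within a row from the right,
-- since the left labels met on the way are needed for the next cell.
backward-unique : ∀ {m} (g g′ : Grid m) → let open Grid in
  (∀ {i} → i < m → p g i m ≡ p g′ i m) → (∀ {j} → j < m → h g m j ≡ h g′ m j) →
  ∀ {i j} → i < m → j ≤ m → p g i j ≡ p g′ i j
backward-unique {m} g g′ top right i<m j≤m = downward Row top row j≤m i<m
  where
  module g = Grid g
  module g′ = Grid g′
  Row : ℕ → Set
  Row j = ∀ {i} → i < m → g.p i j ≡ g′.p i j

  back : ∀ {i j} → i < m → j < m → g.p i (suc j) ≡ g′.p i (suc j) → g.h (suc i) j ≡ g′.h (suc i) j →
         g.p i j ≡ g′.p i j × g.h i j ≡ g′.h i j
  back {i} {j} i<m j<m eq eq′ =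
    cell-backward-unique (subst₂ (Cell _ _) eq eq′ (g.cell i<m j<m)) (g′.cell i<m j<m)

  row : ∀ {j} → j < m → Row (suc j) → Row j
  row {j} j<m above {i} i<m = proj₁ (back i<m j<m (above i<m) (hs i<m))
    where
    hs : ∀ {i} → i ≤ m → g.h i j ≡ g′.h i j
    hs = downward (λ i → g.h i j ≡ g′.h i j) (right j<m) λ i<m eq → proj₂ (back i<m j<m (above i<m) eq)

-- The growth diagram of the permutation σ of {0,…,m-1} with inverse τ: the label of column i
-- becomes positive at height σ i, and that of row j at abscissa τ j.
record Diagram (m : ℕ) (σ τ : ℕ → ℕ) : Set where
  field
    grid   : Grid m
  open Grid grid public
  field
    σ<     : ∀ {i} → i < m → σ i < m
    τ<     : ∀ {j} → j < m → τ j < m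
    p-zero : ∀ {i j} → i < m → j ≤ σ i → p i j ≡ 0
    p-pos  : ∀ {i j} → i < m → σ i < j → j ≤ m → p i j ≢ 0
    h-zero : ∀ {i j} → j < m → i ≤ τ j → h i j ≡ 0
    h-pos  : ∀ {i j} → j < m → τ j < i → i ≤ m → h i j ≢ 0

diagram-swap : ∀ {m σ τ} → Diagram m σ τ → Diagram m τ σ
diagram-swap D = record
  { grid = swap grid ; σ< = τ< ; τ< = σ<
  ; p-zero = h-zero ; p-pos = h-pos ; h-zero = p-zero ; h-pos = p-pos }
  where open Diagram D

module _ {m σ τ} (D : Diagram m σ τ) where
  open Diagram D

  -- `mark` is the only rule that makes a vanishing bottom label positive at the top.
  marked : ∀ {i} → i < m → p i (suc (σ i)) ≡ 1 × h i (σ i) ≡ 0 × h (suc i) (σ i) ≡ 1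
  marked i<m with cell-switch (cell i<m (σ< i<m)) (p-zero i<m ≤-refl) (p-pos i<m ≤-refl (σ< i<m))
  ... | h≡0 , p′≡1 , h′≡1 = p′≡1 , h≡0 , h′≡1

  ones-marked : ∀ {i j} → i < m → j < m → p i (suc j) ≡ 1 → h (suc i) j ≡ 1 → σ i ≡ j
  ones-marked {i} {j} i<m j<m p′≡1 h′≡1 with cell-ones (subst₂ (Cell _ _) p′≡1 h′≡1 (cell i<m j<m))
  ... | p≡0 , _ = ≤-antisym
    (≮⇒≥ λ j<σ → contradiction (trans (sym p′≡1) (p-zero i<m j<σ)) λ ())
    (≮⇒≥ λ σ<j → p-pos i<m σ<j (<⇒≤ j<m) p≡0)

  grow : ∀ {i j} → i ≤ m → j < m → ∀ c → shape (suc j) i c ≡ add (shape j i) (h i j) c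
  grow i≤m j<m = conserve i≤m j<m λ c → cong (λ a → δ a (suc c)) (h-zero j<m z≤n)

  -- The two counts follow the two border paths from the origin to the same point, one ending
  -- horizontally and one vertically.
  shape-transposed : ∀ {i j} → i ≤ m → j ≤ m → ∀ c → shape j i c ≡ Grid.shape (swap grid) i j c
  shape-transposed {i} {zero}  i≤m _   c = count-zero (λ i → p i 0) i (suc c) λ i′<i p≡c →
    contradiction (trans (sym (p-zero (<-≤-trans i′<i i≤m) z≤n)) p≡c) λ ()
  shape-transposed {i} {suc j} i≤m j<m c =
    trans (grow i≤m j<m c) (cong (_+ δ (h i j) (suc c)) (shape-transposed i≤m (<⇒≤ j<m) c))

  shape-partition : ∀ {i j} → i ≤ m → j ≤ m → Partition (shape j i)
  -- At height 0 both entries equal the count over an empty vertical path.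
  shape-partition {i} {zero}  i≤m _   c = ≤-reflexive
    (trans (shape-transposed i≤m z≤n (suc c)) (sym (shape-transposed i≤m z≤n c)))
  shape-partition {i} {suc j} i≤m j<m =
    partition-cong (sym ∘ grow i≤m j<m) (add-partition (shape-partition i≤m (<⇒≤ j<m)) (addable i≤m))
    where
    addable : ∀ {i} → i ≤ m → Addable (h i j) (shape j i)
    addable {zero}  _   c h≡c = contradiction (trans (sym (h-zero j<m z≤n)) h≡c) λ ()
    addable {suc i} i<m =
      addable-step (cell i<m j<m) (shape-partition (<⇒≤ i<m) (<⇒≤ j<m)) (addable (<⇒≤ i<m))

  -- The rows of the boxes of the recording tableau, numbered from 0 (labels start from 1).
  rowWord : ℕ → ℕ
  rowWord i = pred (p i m)

  p-top : ∀ {i} → i < m → p i m ≡ suc (rowWord i)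
  p-top {i} i<m with p i m | p-pos i<m (σ< i<m) ≤-refl
  ... | zero  | ≢0 = contradiction refl ≢0
  ... | suc _ | _  = refl

  rowWord-count : ∀ {k} → k ≤ m → ∀ c → shape m k c ≡ count rowWord k c
  rowWord-count {zero}  _   c = refl
  rowWord-count {suc k} k<m c = cong₂ _+_ (rowWord-count (<⇒≤ k<m) c) (cong (λ a → δ a (suc c)) (p-top k<m))

  rowWord-lattice : Lattice m rowWord
  rowWord-lattice k≤m = partition-cong (rowWord-count k≤m) (shape-partition k≤m ≤-refl)

  -- Going up two adjacent columns, the right label never exceeds the left one. It could start too
  -- early only if the right column had its mark first, and it could overtake only by a bump, which
  -- needs the label between the cells to equal a value that the left cell rules out.
  ascent : ∀ {k} → suc k < m → σ k < σ (suc k) → rowWord (suc k) ≤ rowWord k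
  ascent {k} k<m σ<σ = pred-mono-≤ (invariant ≤-refl)
    where
    local : ∀ {p₁ h₁ p₁′ h₂ p₂ p₂′ h₃} → Cell p₁ h₁ p₁′ h₂ → Cell p₂ h₂ p₂′ h₃ →
            (p₂ ≡ 0 → p₂′ ≢ 0 → p₁ ≢ 0) → p₂ ≤ p₁ → p₂′ ≤ p₁′
    local empty      empty      _ _ = z≤n
    local empty      mark       e _ = contradiction refl (e refl λ ())
    local empty      (pass _)   _ z≤n = z≤n
    local mark       (pass _)   _ z≤n = z≤n
    local (bump c)   (bump .(suc c)) _ q≤p = contradiction q≤p (<⇒≱ ≤-refl)
    local (bump c)   (pass _)   _ q≤p = m≤n⇒m≤1+n q≤p
    local (pass _)   empty      _ _ = z≤n
    local (pass p≢0) mark       _ _ = n≢0⇒n>0 p≢0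
    local (pass p≢h) (bump c)   _ q≤p = ≤∧≢⇒< q≤p (≢-sym p≢h)
    local (pass _)   (pass _)   _ q≤p = q≤p

    invariant : ∀ {j} → j ≤ m → p (suc k) j ≤ p k j
    invariant {zero}  _   = ≤-reflexive (trans (p-zero k<m z≤n) (sym (p-zero (<⇒≤ k<m) z≤n)))
    invariant {suc j} j<m = local (cell (<⇒≤ k<m) j<m) (cell k<m j<m)
      (λ p≡0 p′≢0 → p-pos (<⇒≤ k<m) (<-≤-trans σ<σ (≮⇒≥ λ j<σ → p′≢0 (p-zero k<m j<σ))) (<⇒≤ j<m))
      (invariant (<⇒≤ j<m))

  -- The right label starts first and stays strictly ahead: when the left label rises by one and
  -- catches up with the right one, it also leaves through the shared edge and bumps the right label
  -- in turn.
  descent : ∀ {k} → suc k < m → σ (suc k) < σ k → rowWord k < rowWord (suc k)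
  descent {k} k<m σ<σ with invariant ≤-refl
    where
    -- Both labels vanish below the two marks, where strictness is not yet available.
    Inv : (p₁ p₂ : ℕ) → Set
    Inv p₁ p₂ = p₁ < p₂ ⊎ (p₁ ≡ 0 × p₂ ≡ 0)

    zero-or : ∀ p → Inv 0 p
    zero-or zero    = inj₂ (refl , refl)
    zero-or (suc _) = inj₁ z<s

    local : ∀ {p₁ h₁ p₁′ h₂ p₂ p₂′ h₃} → Cell p₁ h₁ p₁′ h₂ → Cell p₂ h₂ p₂′ h₃ →
            (p₁ ≡ 0 → p₁′ ≢ 0 → p₂ ≢ 0) → Inv p₁ p₂ → Inv p₁′ p₂′
    local empty      _          _ _ = zero-or _
    local mark       (bump .0)  _ _ = inj₁ ≤-refl
    local mark       (pass ≢1)  e _ = inj₁ (≤∧≢⇒< (n≢0⇒n>0 (e refl λ ())) (≢-sym ≢1))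
    local (bump c)   (bump .(suc c)) _ _ = inj₁ ≤-refl
    local (bump c)   (pass ≢c)  _ (inj₁ p<q) = inj₁ (≤∧≢⇒< p<q (≢-sym ≢c))
    local (pass ≢h)  (pass _)   _ inv = inv
    local (pass 0≢0) empty      _ (inj₂ (refl , _)) = contradiction refl 0≢0
    local (pass 0≢0) mark       _ (inj₂ (refl , _)) = contradiction refl 0≢0
    local (pass _)   (bump c)   _ (inj₁ p<q) = inj₁ (m<n⇒m<1+n p<q)

    invariant : ∀ {j} → j ≤ m → Inv (p k j) (p (suc k) j)
    invariant {zero}  _   = inj₂ (p-zero (<⇒≤ k<m) z≤n , p-zero k<m z≤n)
    invariant {suc j} j<m = local (cell (<⇒≤ k<m) j<m) (cell k<m j<m)
      (λ p≡0 p′≢0 → p-pos k<m (<-≤-trans σ<σ (≮⇒≥ λ j<σ → p′≢0 (p-zero (<⇒≤ k<m) j<σ))) (<⇒≤ j<m))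
      (invariant (<⇒≤ j<m))
  ... | inj₁ p<q = s≤s⁻¹ (subst₂ _<_ (p-top (<⇒≤ k<m)) (p-top k<m) p<q)
  ... | inj₂ (p≡0 , _) = contradiction p≡0 (p-pos (<⇒≤ k<m) (σ< (<⇒≤ k<m)) ≤-refl)

rowWords-content : ∀ {m σ τ} (D : Diagram m σ τ) → ∀ c →
  count (rowWord D) m c ≡ count (rowWord (diagram-swap D)) m c
rowWords-content {m} D c = begin
  count (rowWord D) m c                   ≡⟨ rowWord-count D ≤-refl c ⟨
  Diagram.shape D m m c                   ≡⟨ shape-transposed D ≤-refl ≤-refl c ⟩
  Diagram.shape (diagram-swap D) m m c    ≡⟨ rowWord-count (diagram-swap D) ≤-refl c ⟩
  count (rowWord (diagram-swap D)) m c    ∎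
  where open ≡-Reasoning

-- Cell by cell from the origin; `σ` tells at which height a column becomes positive and so decides
-- between `empty` and `mark`. It lets the diagram built forwards replace the one built backwards.
forward-unique : ∀ {m σ τ σ′ τ′} (D : Diagram m σ τ) (D′ : Diagram m σ′ τ′) → let open Diagram in
  (∀ {i} → i < m → σ i ≡ σ′ i) → ∀ {i j} → i ≤ m → j ≤ m → (i < m → p D i j ≡ p D′ i j) × (j < m → h D i j ≡ h D′ i j)
forward-unique {m} D D′ σ≡σ′ {i} {j} i≤m j≤m = ps i j j≤m , hs i j i≤m
  where
  module D = Diagram D
  module D′ = Diagram D′
  hs : ∀ i j → i ≤ m → j < m → D.h i j ≡ D′.h i j
  ps : ∀ i j → j ≤ m → i < m → D.p i j ≡ D′.p i j

  next : ∀ {i j} → i < m → j < m → D.p i j ≡ D′.p i j → D.h i j ≡ D′.h i j →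
         D.p i (suc j) ≡ D′.p i (suc j) × D.h (suc i) j ≡ D′.h (suc i) j
  next {i} {j} i<m j<m eq eq′ = cell-forward-unique (subst₂ (λ a b → Cell a b _ _) eq eq′ (D.cell i<m j<m)) (D′.cell i<m j<m)
    (λ ≡0 → D′.p-zero i<m (≤-trans (≮⇒≥ λ σ<j → D.p-pos i<m σ<j j<m ≡0) (≤-reflexive (σ≡σ′ i<m))))
    (λ ≡0 → D.p-zero i<m (≤-trans (≮⇒≥ λ σ<j → D′.p-pos i<m σ<j j<m ≡0) (≤-reflexive (sym (σ≡σ′ i<m)))))

  hs zero    j _   j<m = trans (D.h-zero j<m z≤n) (sym (D′.h-zero j<m z≤n))
  hs (suc i) j i<m j<m = proj₂ (next i<m j<m (ps i j (<⇒≤ j<m) i<m) (hs i j (<⇒≤ i<m) j<m))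
  ps i zero    _   i<m = trans (D.p-zero i<m z≤n) (sym (D′.p-zero i<m z≤n))
  ps i (suc j) j<m i<m = proj₁ (next i<m j<m (ps i j (<⇒≤ j<m) i<m) (hs i j (<⇒≤ i<m) j<m))

switch-≤ : ∀ {m σ τ σ′ τ′} (D : Diagram m σ τ) (D′ : Diagram m σ′ τ′) → ∀ {i} → i < m →
  (∀ {j} → j ≤ m → Diagram.p D i j ≡ Diagram.p D′ i j) → σ i ≤ σ′ i
switch-≤ D D′ i<m eq = ≮⇒≥ λ σ′<σ → Diagram.p-pos D′ i<m σ′<σ (<⇒≤ (Diagram.σ< D i<m))
  (trans (sym (eq (<⇒≤ (Diagram.σ< D i<m)))) (Diagram.p-zero D i<m ≤-refl))

-- The two words are the labels on the top and right borders. They determine all labels below, and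
-- `σ i` is the height where column i turns positive.
permutation-unique : ∀ {m σ τ σ′ τ′} (D : Diagram m σ τ) (D′ : Diagram m σ′ τ′) →
  (∀ {k} → k < m → rowWord D k ≡ rowWord D′ k) →
  (∀ {k} → k < m → rowWord (diagram-swap D) k ≡ rowWord (diagram-swap D′) k) →
  ∀ {i} → i < m → σ i ≡ σ′ i
permutation-unique {m} D D′ a≡ b≡ i<m =
  ≤-antisym (switch-≤ D D′ i<m (eq i<m)) (switch-≤ D′ D i<m (sym ∘ eq i<m))
  where
  eq : ∀ {i j} → i < m → j ≤ m → Diagram.p D i j ≡ Diagram.p D′ i j
  eq = backward-unique (Diagram.grid D) (Diagram.grid D′)
    (λ k<m → trans (p-top D k<m) (trans (cong suc (a≡ k<m)) (sym (p-top D′ k<m))))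
    (λ k<m → trans (p-top (diagram-swap D) k<m) (trans (cong suc (b≡ k<m)) (sym (p-top (diagram-swap D′) k<m))))

-- Diagrams built from permutations and from pairs of tableaux

raise : Bool → ℕ → ℕ
raise marked zero    = if marked then 1 else 0
raise marked (suc c) = suc (suc c)

-- The label leaving opposite to `p`. The rules are symmetric under reflection, so exchanging the
-- arguments gives the other outgoing label.
through : Bool → ℕ → ℕ → ℕ
through marked p h = if ⌊ p ≟ h ⌋ then raise marked p else p

through-cell : ∀ marked p h → Cell p h (through marked p h) (through marked h p)
through-cell marked p h with p ≟ h | h ≟ p
through-cell false zero    _ | yes refl | yes _ = empty
through-cell true  zero    _ | yes refl | yes _ = mark
through-cell _     (suc c) _ | yes refl | yes _ = bump c
... | yes refl | no ≢   = contradiction refl ≢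
... | no ≢     | yes eq = contradiction (sym eq) ≢
... | no ≢     | no _   = pass ≢

through-unmarked : ∀ {p} h → p ≡ 0 → through false p h ≡ 0
through-unmarked h refl with 0 ≟ h
... | yes _ = refl
... | no _  = refl

through-marked : ∀ {A : Set} (A? : Dec A) {p h} → A → p ≡ 0 → h ≡ 0 → through ⌊ A? ⌋ p h ≢ 0
through-marked (yes _)  _ refl refl = λ ()
through-marked (no ¬a) a _    _    = contradiction a ¬a

module Forward {m} (σ τ : ℕ → ℕ)
  (σ< : ∀ {i} → i < m → σ i < m) (τ< : ∀ {j} → j < m → τ j < m)
  (τσ : ∀ {i} → i < m → τ (σ i) ≡ i) (στ : ∀ {j} → j < m → σ (τ j) ≡ j) where

  p h : ℕ → ℕ → ℕ
  p i zero    = 0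
  p i (suc j) = through ⌊ σ i ≟ j ⌋ (p i j) (h i j)
  h zero    j = 0
  h (suc i) j = through ⌊ σ i ≟ j ⌋ (h i j) (p i j)

  cell : ∀ i j → Cell (p i j) (h i j) (p i (suc j)) (h (suc i) j)
  cell i j = through-cell ⌊ σ i ≟ j ⌋ (p i j) (h i j)

  p-zero : ∀ i j → i < m → j ≤ σ i → p i j ≡ 0
  p-zero i zero    _   _   = refl
  p-zero i (suc j) i<m j<σ with σ i ≟ j
  ... | yes refl = contradiction j<σ (<-irrefl refl)
  ... | no _     = through-unmarked (h i j) (p-zero i j i<m (<⇒≤ j<σ))

  h-zero : ∀ i j → j < m → i ≤ τ j → h i j ≡ 0
  h-zero zero    j _   _   = refl
  h-zero (suc i) j j<m i<τ with σ i ≟ j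
  ... | yes refl = contradiction (≤-trans i<τ (≤-reflexive (τσ (<-trans i<τ (τ< j<m))))) (<-irrefl refl)
  ... | no _     = through-unmarked (p i j) (h-zero i j j<m (<⇒≤ i<τ))

  p-pos : ∀ i j → i < m → σ i < j → p i j ≢ 0
  p-pos i (suc j) i<m (s≤s σ≤j) with m≤n⇒m<n∨m≡n σ≤j
  ... | inj₁ σ<j  = cell-positive (cell i j) (p-pos i j i<m σ<j)
  ... | inj₂ refl = through-marked (σ i ≟ j) refl (p-zero i j i<m ≤-refl)
                      (h-zero i j (σ< i<m) (≤-reflexive (sym (τσ i<m))))

  h-pos : ∀ i j → j < m → τ j < i → h i j ≢ 0
  h-pos (suc i) j j<m (s≤s τ≤i) with m≤n⇒m<n∨m≡n τ≤i
  ... | inj₁ τ<i  = cell-positive (cell-swap (cell i j)) (h-pos i j j<m τ<i)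
  ... | inj₂ refl = through-marked (σ i ≟ j) (στ j<m) (h-zero i j j<m ≤-refl)
                      (p-zero i j (τ< j<m) (≤-reflexive (sym (στ j<m))))

  diagram : Diagram m σ τ
  diagram = record
    { grid = record { p = p ; h = h ; cell = λ {i} {j} _ _ → cell i j }
    ; σ< = σ< ; τ< = τ<
    ; p-zero = p-zero _ _ ; p-pos = λ {i} {j} i<m σ<j _ → p-pos i j i<m σ<j
    ; h-zero = h-zero _ _ ; h-pos = λ {i} {j} j<m τ<i _ → h-pos i j j<m τ<i }

-- All backward rules at once: equal labels drop by one, where `pred 0 = 0` is `empty` and
-- `pred 1 = 0` is `mark`.
before : ℕ → ℕ → ℕ
before p h = if ⌊ p ≟ h ⌋ then pred p else p

before-cell : ∀ p h → Cell (before p h) (before h p) p h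
before-cell p h with p ≟ h | h ≟ p
before-cell zero          _ | yes refl | yes _ = empty
before-cell (suc zero)    _ | yes refl | yes _ = mark
before-cell (suc (suc c)) _ | yes refl | yes _ = bump c
... | yes refl | no ≢   = contradiction refl ≢
... | no ≢     | yes eq = contradiction (sym eq) ≢
... | no ≢     | no _   = pass ≢

-- A downward search for the last zero of `f` below `m`. The final 0 is a default that the premises
-- of `switch-switches` keep from being reached.
switch : (ℕ → ℕ) → ℕ → ℕ
switch f zero    = 0
switch f (suc m) with f m ≟ 0
... | yes _ = m
... | no  _ = switch f m

record Switches (f : ℕ → ℕ) (m s : ℕ) : Set where
  field
    bound : s < m
    zeros : ∀ {j} → j ≤ s → f j ≡ 0
    pos   : ∀ {j} → s < j → j ≤ m → f j ≢ 0

positive-mono : ∀ (f : ℕ → ℕ) {m} → (∀ {j} → j < m → f j ≢ 0 → f (suc j) ≢ 0) → ∀ {j k} → j ≤ k → k ≤ m → f j ≢ 0 → f k ≢ 0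
positive-mono f stay {j} {k} j≤k k≤m fj≢0 with m≤n⇒m<n∨m≡n j≤k
positive-mono f stay {j} {suc k} _ k<m fj≢0 | inj₁ (s≤s j≤k) = stay k<m (positive-mono f stay j≤k (<⇒≤ k<m) fj≢0)
... | inj₂ refl = fj≢0

switch-switches : ∀ f m → f 0 ≡ 0 → f m ≢ 0 → (∀ {j} → j < m → f j ≢ 0 → f (suc j) ≢ 0) → Switches f m (switch f m)
switch-switches f zero    f0 fm _ = contradiction f0 fm
switch-switches f (suc m) f0 fm stay with f m ≟ 0
... | yes fm≡0 = record
  { bound = ≤-refl
  ; zeros = zeros
  ; pos   = λ m<j j≤m → subst (λ j → f j ≢ 0) (≤-antisym m<j j≤m) fm }
  where
  zeros : ∀ {j} → j ≤ m → f j ≡ 0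
  zeros {j} j≤m with f j ≟ 0
  ... | yes eq = eq
  ... | no ≢0  = contradiction fm≡0 (positive-mono f stay j≤m (n≤1+n m) ≢0)
... | no fm≢0 = record { bound = m<n⇒m<1+n bound ; zeros = zeros ; pos = pos′ }
  where
  open Switches (switch-switches f m f0 fm≢0 (stay ∘ m<n⇒m<1+n))
  pos′ : ∀ {j} → switch f m < j → j ≤ suc m → f j ≢ 0
  pos′ {j} s<j j≤1+m with m≤n⇒m<n∨m≡n j≤1+m
  ... | inj₁ (s≤s j≤m) = pos s<j j≤m
  ... | inj₂ refl      = fm

switches-unique : ∀ {f m s j} → Switches f m s → j < m → f j ≡ 0 → f (suc j) ≢ 0 → s ≡ j
switches-unique S j<m fj fj′ = ≤-antisym
  (≮⇒≥ λ j<s → fj′ (zeros j<s)) (≮⇒≥ λ s<j → pos s<j (<⇒≤ j<m) fj)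
  where open Switches S

module Backward {m} (a b : ℕ → ℕ) (a-lattice : Lattice m a) (b-lattice : Lattice m b)
  (content : ∀ c → count a m c ≡ count b m c) where

  -- Both coordinates count from the far corner.
  P H : ℕ → ℕ → ℕ
  P i zero    = suc (a (m ∸ suc i))
  P i (suc j) = before (P i j) (H i j)
  H zero    j = suc (b (m ∸ suc j))
  H (suc i) j = before (H i j) (P i j)

  p h : ℕ → ℕ → ℕ
  p i j = P (m ∸ suc i) (m ∸ j)
  h i j = H (m ∸ i) (m ∸ suc j)

  reflect : ∀ {i m} → i < m → m ∸ suc (m ∸ suc i) ≡ i
  reflect {i} {m} i<m = trans (cong (m ∸_) (sym (+-∸-assoc 1 i<m))) (m∸[m∸n]≡n (<⇒≤ i<m))

  cell : ∀ {i j} → i < m → j < m → Cell (p i j) (h i j) (p i (suc j)) (h (suc i) j)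
  -- This turns `m ∸ i` into `suc (m ∸ suc i)`, and likewise for `j`, so that the recursive clauses
  -- of `P` and `H` apply.
  cell {i} {j} i<m j<m rewrite +-∸-assoc 1 i<m | +-∸-assoc 1 j<m =
    before-cell (P (m ∸ suc i) (m ∸ suc j)) (H (m ∸ suc i) (m ∸ suc j))

  grid : Grid m
  grid = record { p = p ; h = h ; cell = cell }

  open Grid grid using (shape; conserve)

  top : ∀ {i} → i < m → p i m ≡ suc (a i)
  top {i} i<m rewrite n∸n≡0 m = cong (suc ∘ a) (reflect i<m)

  side : ∀ {j} → j < m → h m j ≡ suc (b j)
  side {j} j<m rewrite n∸n≡0 m = cong (suc ∘ b) (reflect j<m)

  shape-top : ∀ {k} → k ≤ m → ∀ c → count a k c ≡ shape m k c
  shape-top {k} k≤m c = trans (count-suc k) (count-cong k λ i<k → sym (top (<-≤-trans i<k k≤m)))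
    where
    -- Passing from rows to labels changes nothing, as `δ` strips a successor from both arguments.
    count-suc : ∀ k → count a k c ≡ count (suc ∘ a) k (suc c)
    count-suc zero    = refl
    count-suc (suc k) = cong (_+ δ (a k) c) (count-suc k)

  -- The invariant of the descent: at the right border the shape is that of the first `j` boxes of
  -- `b`, hence empty at height 0.
  record Row (j : ℕ) : Set where
    field
      partition : ∀ {i} → i ≤ m → Partition (shape j i)
      right     : ∀ c → shape j m c ≡ count b j c

  -- On the right border the label names the last box added to `b`, which is removable;
  -- `corner-step` carries this to the left.
  corners : ∀ {j} → j < m → Row (suc j) → ∀ {i} → i ≤ m → Corner (h i j) (shape (suc j) i)
  corners {j} j<m row = downward (λ i → Corner (h i j) (shape (suc j) i)) last
    λ i<m → corner-step (cell i<m j<m) (Row.partition row i<m)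
    where
    last : Corner (h m j) (shape (suc j) m)
    last = subst (λ a → Corner a (shape (suc j) m)) (sym (side j<m))
      (corner-cong (sym ∘ Row.right row) (add-corner (b-lattice (<⇒≤ j<m)) (b-lattice j<m)))

  -- At abscissa 0 the shape is empty and has no removable box, so the label there cannot be
  -- positive.
  left-zero : ∀ {j} → j < m → Row (suc j) → h 0 j ≡ 0
  left-zero {j} j<m row with h 0 j | corners j<m row z≤n
  ... | zero  | _   = refl
  ... | suc c | cor = contradiction (cor c refl) λ ()

  shrink : ∀ {j} → j < m → Row (suc j) → ∀ {i} → i ≤ m → ∀ c → shape (suc j) i c ≡ add (shape j i) (h i j) c
  shrink j<m row i≤m = conserve i≤m j<m λ c → cong (λ a → δ a (suc c)) (left-zero j<m row)

  row-step : ∀ {j} → j < m → Row (suc j) → Row j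
  row-step {j} j<m row = record
    { partition = λ i≤m → remove-partition
        (partition-cong (shrink j<m row i≤m) (Row.partition row i≤m))
        (corner-cong (shrink j<m row i≤m) (corners j<m row i≤m))
    ; right = λ c → +-cancelʳ-≡ _ _ _ (begin
        shape j m c + δ (b j) c           ≡⟨ cong (λ a → shape j m c + δ a (suc c)) (side j<m) ⟨
        add (shape j m) (h m j) c         ≡⟨ shrink j<m row ≤-refl c ⟨
        shape (suc j) m c                 ≡⟨ Row.right row c ⟩
        count b j c + δ (b j) c           ∎) }
    where open ≡-Reasoning

  rows : ∀ {j} → j ≤ m → Row j
  rows = downward Row
    record { partition = λ i≤m → partition-cong (shape-top i≤m) (a-lattice i≤m)
           ; right = λ c → trans (sym (shape-top ≤-refl c)) (content c) }
    row-step

  bottom : ∀ {i} → i < m → p i 0 ≡ 0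
  bottom {i} i<m with p i 0 in eq
  ... | zero  = refl
  ... | suc c = contradiction eq (count-absent (λ i → p i 0) m (Row.right (rows z≤n) c) i<m)

  left : ∀ {j} → j < m → h 0 j ≡ 0
  left j<m = left-zero j<m (rows j<m)

  σ τ : ℕ → ℕ
  σ i = switch (p i) m
  τ j = switch (λ i → h i j) m

  σ-switches : ∀ {i} → i < m → Switches (p i) m (σ i)
  σ-switches {i} i<m = switch-switches (p i) m (bottom i<m)
    (λ eq → contradiction (trans (sym (top i<m)) eq) λ ())
    (λ j<m → cell-positive (cell i<m j<m))

  τ-switches : ∀ {j} → j < m → Switches (λ i → h i j) m (τ j)
  τ-switches {j} j<m = switch-switches (λ i → h i j) m (left j<m)
    (λ eq → contradiction (trans (sym (side j<m)) eq) λ ())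
    (λ i<m → cell-positive (cell-swap (cell i<m j<m)))

  diagram : Diagram m σ τ
  diagram = record
    { grid   = grid
    ; σ<     = Switches.bound ∘ σ-switches
    ; τ<     = Switches.bound ∘ τ-switches
    ; p-zero = λ k<m → Switches.zeros (σ-switches k<m)
    ; p-pos  = λ k<m → Switches.pos (σ-switches k<m)
    ; h-zero = λ k<m → Switches.zeros (τ-switches k<m)
    ; h-pos  = λ k<m → Switches.pos (τ-switches k<m) }

  rowWord-a : ∀ {k} → k < m → rowWord diagram k ≡ a k
  rowWord-a k<m = cong pred (top k<m)

  rowWord-b : ∀ {k} → k < m → rowWord (diagram-swap diagram) k ≡ b k
  rowWord-b k<m = cong pred (side k<m)

-- The cell where column `i` turns positive is a `mark`, so row `σ i` turns positive in the same
-- cell.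
diagram-inverse : ∀ {m σ τ} → Diagram m σ τ → ∀ {i} → i < m → τ (σ i) ≡ i
diagram-inverse D i<m with marked D i<m
... | _ , h≡0 , h′≡1 = switches-unique
  (record { bound = τ< (σ< i<m) ; zeros = h-zero (σ< i<m) ; pos = h-pos (σ< i<m) })
  i<m h≡0 λ h′≡0 → contradiction (trans (sym h′≡1) h′≡0) λ ()
  where open Diagram D

-- Increasing subsequences

lookup-injective : ∀ {A : Set} (f : A → ℕ) {xs} → AllPairs (_≢_ on f) xs →
  ∀ {i j} → f (List.lookup xs i) ≡ f (List.lookup xs j) → i ≡ j
lookup-injective f (_ ∷ _)    {Fin.zero}  {Fin.zero}  _  = refl
lookup-injective f (≢x ∷ _)   {Fin.zero}  {Fin.suc j} eq = contradiction eq (All.lookup ≢x (∈-lookup j))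
lookup-injective f (≢x ∷ _)   {Fin.suc i} {Fin.zero}  eq = contradiction (sym eq) (All.lookup ≢x (∈-lookup i))
lookup-injective f (_ ∷ rest) {Fin.suc i} {Fin.suc j} eq = cong Fin.suc (lookup-injective f rest eq)

distinct-length : ∀ {A : Set} (f : A → ℕ) {xs ℓ} → All (λ x → f x < ℓ) xs → AllPairs (_≢_ on f) xs → length xs ≤ ℓ
distinct-length f {xs} f< f≢ = injective⇒≤ {f = λ i → fromℕ< (bound i)}
  λ {i} {j} eq → lookup-injective f f≢ (fromℕ<-injective _ _ (bound i) (bound j) eq)
  where
  bound : ∀ i → f (List.lookup xs i) < _
  bound i = All.lookup f< (∈-lookup i)

module _ {m σ τ} (D : Diagram m σ τ) where
  open Diagram D

  width : ℕ
  width = shape m m 0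

  Below : ℕ → ℕ → Set
  Below k l = k < l × σ k < σ l

  shape-mono : ∀ {i i′ j j′} → i ≤ i′ → i′ ≤ m → j ≤ j′ → j′ ≤ m → ∀ c → shape j i c ≤ shape j′ i′ c
  shape-mono {i} {i′} {j} {j′} i≤i′ i′≤m j≤j′ j′≤m c = begin
    shape j i c                       ≡⟨ shape-transposed D (≤-trans i≤i′ i′≤m) (≤-trans j≤j′ j′≤m) c ⟩
    Grid.shape (swap grid) i j c      ≤⟨ count-mono (h i) (suc c) j≤j′ ⟩
    Grid.shape (swap grid) i j′ c     ≡⟨ shape-transposed D (≤-trans i≤i′ i′≤m) j′≤m c ⟨
    shape j′ i c                      ≤⟨ count-mono (λ i → p i j′) (suc c) i≤i′ ⟩
    shape j′ i′ c                     ∎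
    where open ≤-Reasoning

  -- The left edge of a marked cell carries 0 and its top edge 1: crossing the cell adds exactly one
  -- box to the first row.
  mark-width : ∀ {i} → i < m → shape (suc (σ i)) (suc i) 0 ≡ suc (shape (σ i) i 0)
  mark-width {i} i<m = begin
    shape (suc (σ i)) (suc i) 0                          ≡⟨ cong (shape (suc (σ i)) i 0 +_) (cong (λ a → δ a 1) (proj₁ (marked D i<m))) ⟩
    shape (suc (σ i)) i 0 + 1                            ≡⟨ +-comm _ 1 ⟩
    suc (shape (suc (σ i)) i 0)                          ≡⟨ cong suc (grow D (<⇒≤ i<m) (σ< i<m) 0) ⟩
    suc (shape (σ i) i 0 + δ (h i (σ i)) 1)              ≡⟨ cong (λ a → suc (shape (σ i) i 0 + δ a 1)) (proj₁ (proj₂ (marked D i<m))) ⟩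
    suc (shape (σ i) i 0 + 0)                            ≡⟨ cong suc (+-identityʳ _) ⟩
    suc (shape (σ i) i 0)                                ∎
    where open ≡-Reasoning

  -- The first row at the lower left corner of the cell of point k. Comparable points have different
  -- ranks, all below `width`, which reduces the upper bound on increasing subsequences to the
  -- pigeonhole principle.
  rank : ℕ → ℕ
  rank k = shape (σ k) k 0

  rank-bound : ∀ {k} → k < m → rank k < width
  rank-bound k<m = ≤-trans (≤-reflexive (sym (mark-width k<m))) (shape-mono k<m ≤-refl (σ< k<m) ≤-refl 0)

  rank-mono : ∀ {k l} → l < m → Below k l → rank k < rank l
  rank-mono {k} l<m (k<l , σk<σl) = ≤-trans (≤-reflexive (sym (mark-width (<-trans k<l l<m))))
    (shape-mono k<l (<⇒≤ l<m) σk<σl (<⇒≤ (σ< l<m)) 0)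

  -- Listed from the last point back to the first, so that a new upper right point is put in front.
  Chain : ℕ → ℕ → Set
  Chain i j = ∃[ ks ] AllPairs (flip Below) ks × All (λ k → k < i × σ k < j) ks × length ks ≡ shape j i 0

  -- A label 1 leaving a cell both upwards and to the right marks a point there; otherwise
  -- the length of the first row is the same as at one of the two neighbouring corners.
  longest : ∀ i j → i ≤ m → j ≤ m → Chain i j
  longest zero    j       _   _   = [] , [] , [] , refl
  longest (suc i) zero    i<m _   = [] , [] , [] , sym (shape-transposed D i<m z≤n 0)
  longest (suc i) (suc j) i<m j<m with p i (suc j) ≟ 1 | h (suc i) j ≟ 1
  ... | no ≢1 | _ with longest i (suc j) (<⇒≤ i<m) j<m
  ... | ks , chain , inside , len =
    ks , chain , All.map (λ (k<i , σ<j) → m<n⇒m<1+n k<i , σ<j) inside ,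
    trans len (sym (trans (cong (shape (suc j) i 0 +_) (δ-≢ ≢1)) (+-identityʳ _)))
  longest (suc i) (suc j) i<m j<m | yes _ | no ≢1 with longest (suc i) j i<m (<⇒≤ j<m)
  ... | ks , chain , inside , len =
    ks , chain , All.map (λ (k<i , σ<j) → k<i , m<n⇒m<1+n σ<j) inside ,
    trans len (sym (trans (grow D i<m j<m 0) (trans (cong (shape j (suc i) 0 +_) (δ-≢ ≢1)) (+-identityʳ _))))
  longest (suc i) (suc j) i<m j<m | yes p′≡1 | yes h′≡1 with longest i j (<⇒≤ i<m) (<⇒≤ j<m)
  ... | ks , chain , inside , len with refl ← ones-marked D i<m j<m p′≡1 h′≡1 =
    i ∷ ks , inside ∷ chain ,
    (≤-refl , ≤-refl) ∷ All.map (λ (k<i , σ<j) → m<n⇒m<1+n k<i , m<n⇒m<1+n σ<j) inside ,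
    trans (cong suc len) (sym (mark-width i<m))

-- Configurations of multigraphs

when : ∀ {A : Set} → Dec A → ℕ → ℕ
when A? x = if ⌊ A? ⌋ then x else 0

when-yes : ∀ {A : Set} (A? : Dec A) {x} → A → when A? x ≡ x
when-yes (yes _) _ = refl
when-yes (no ¬a) a = contradiction a ¬a

when-no : ∀ {A : Set} (A? : Dec A) {x} → ¬ A → when A? x ≡ 0
when-no (yes a) ¬a = contradiction a ¬a
when-no (no _)  _  = refl

when-⇔ : ∀ {A B : Set} (A? : Dec A) (B? : Dec B) {x} → (A → B) → (B → A) → when A? x ≡ when B? x
when-⇔ (yes a) B? f g = sym (when-yes B? (f a))
when-⇔ (no ¬a) B? f g = sym (when-no B? (¬a ∘ g))

when-zero : ∀ {A : Set} (A? : Dec A) → when A? 0 ≡ 0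
when-zero (yes _) = refl
when-zero (no _)  = refl

Σ-cong : ∀ {n} {f g : Fin n → ℕ} → (∀ i → f i ≡ g i) → Σᶠ f ≡ Σᶠ g
Σ-cong = sum-cong-≗

Σ-mono : ∀ {n} {f g : Fin n → ℕ} → (∀ i → f i ≤ g i) → Σᶠ f ≤ Σᶠ g
Σ-mono {zero}  _   = z≤n
Σ-mono {suc n} f≤g = +-mono-≤ (f≤g Fin.zero) (Σ-mono (f≤g ∘ Fin.suc))

Σ-mono-at : ∀ {n} {f g : Fin n → ℕ} i {x} → f i + x ≤ g i → (∀ i → f i ≤ g i) → Σᶠ f + x ≤ Σᶠ g
Σ-mono-at {f = f} {g} Fin.zero {x} at f≤g = begin
  f Fin.zero + Σᶠ (f ∘ Fin.suc) + x   ≡⟨ +-assoc (f Fin.zero) _ x ⟩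
  f Fin.zero + (Σᶠ (f ∘ Fin.suc) + x) ≡⟨ cong (f Fin.zero +_) (+-comm _ x) ⟩
  f Fin.zero + (x + Σᶠ (f ∘ Fin.suc)) ≡⟨ +-assoc (f Fin.zero) x _ ⟨
  f Fin.zero + x + Σᶠ (f ∘ Fin.suc)   ≤⟨ +-mono-≤ at (Σ-mono (f≤g ∘ Fin.suc)) ⟩
  g Fin.zero + Σᶠ (g ∘ Fin.suc)       ∎
  where open ≤-Reasoning
Σ-mono-at {f = f} {g} (Fin.suc i) {x} at f≤g = begin
  f Fin.zero + Σᶠ (f ∘ Fin.suc) + x   ≡⟨ +-assoc (f Fin.zero) _ x ⟩
  f Fin.zero + (Σᶠ (f ∘ Fin.suc) + x) ≤⟨ +-mono-≤ (f≤g Fin.zero) (Σ-mono-at i at (f≤g ∘ Fin.suc)) ⟩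
  g Fin.zero + Σᶠ (g ∘ Fin.suc)       ∎
  where open ≤-Reasoning

Σ-zero : ∀ {n} {f : Fin n → ℕ} → (∀ i → f i ≡ 0) → Σᶠ f ≡ 0
Σ-zero {n} f≡0 = trans (Σ-cong f≡0) (sum-replicate-zero n)

Σ-single : ∀ {n} {f : Fin n → ℕ} i → (∀ j → j ≢ i → f j ≡ 0) → Σᶠ f ≡ f i
Σ-single {f = f} Fin.zero    zeros =
  trans (cong (f Fin.zero +_) (Σ-zero λ j → zeros (Fin.suc j) λ ())) (+-identityʳ _)
Σ-single {f = f} (Fin.suc i) zeros = cong₂ _+_ (zeros Fin.zero λ ())
  (Σ-single i λ j j≢i → zeros (Fin.suc j) (j≢i ∘ Fin.suc-injective))

Σ-ones : ∀ n → Σᶠ {n} (λ _ → 1) ≡ n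
Σ-ones zero    = refl
Σ-ones (suc n) = cong suc (Σ-ones n)

Σ-below : ∀ {n} (k : Fin n) → Σᶠ (λ (k′ : Fin n) → when (k′ Fin.<? k) 1) ≡ toℕ k
Σ-below {suc n} Fin.zero    = Σ-zero {suc n} λ k′ → when-no (k′ Fin.<? Fin.zero {n}) {1} λ ()
Σ-below {suc n} (Fin.suc k) = cong suc (trans
  (Σ-cong λ (k′ : Fin n) → when-⇔ (Fin.suc k′ Fin.<? Fin.suc k) (k′ Fin.<? k) {1} s≤s⁻¹ s≤s) (Σ-below k))

when-Σ : ∀ {A : Set} (A? : Dec A) {n} (f : Fin n → ℕ) → when A? (Σᶠ f) ≡ Σᶠ (λ i → when A? (f i))
when-Σ (yes _)     f = refl
when-Σ (no _)  {n} f = sym (Σ-zero {n} λ _ → refl)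

-- `edgesAfterV G u v` and `edgesAfterU G u v` are instances of this by computation.
after : ∀ {n} → (Fin n → ℕ) → Fin n → ℕ
after g v = Σᶠ (λ v′ → when (v Fin.<? v′) (g v′))

after-step : ∀ {n} (g : Fin n → ℕ) {v w} → v Fin.< w → after g w + g w ≤ after g v
after-step g {v} {w} v<w = Σ-mono-at w
  (≤-reflexive (trans (cong (_+ g w) (when-no (w Fin.<? w) (<-irrefl refl))) (sym (when-yes (v Fin.<? w) v<w))))
  le
  where
  le : ∀ i → when (w Fin.<? i) (g i) ≤ when (v Fin.<? i) (g i)
  le i with w Fin.<? i
  ... | yes w<i = ≤-reflexive (sym (when-yes (v Fin.<? i) (<-trans v<w w<i)))
  ... | no _    = z≤n

after-total : ∀ {n} (g : Fin n → ℕ) v → after g v + g v ≤ Σᶠ g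
after-total g v = Σ-mono-at v
  (≤-reflexive (cong (_+ g v) (when-no (v Fin.<? v) (<-irrefl refl)))) le
  where
  le : ∀ i → when (v Fin.<? i) (g i) ≤ g i
  le i with v Fin.<? i
  ... | yes _ = ≤-refl
  ... | no _  = z≤n

code : ∀ {n r} → Fin n × Fin r → ℕ
code (u , k) = toℕ (combine u k)

module _ {n r : ℕ} where

  code<n*r : (x : Fin n × Fin r) → code x < n * r
  code<n*r (u , k) = toℕ<n (combine u k)

  code-injective : {x y : Fin n × Fin r} → code x ≡ code y → x ≡ y
  code-injective {u , k} {v , l} eq = ×-≡,≡→≡ (combine-injective u k v l (toℕ-injective eq))

  code-<ˡ : {u v : Fin n} {k l : Fin r} → u Fin.< v → code (u , k) < code (v , l)
  code-<ˡ {k = k} {l} u<v = combine-monoˡ-< k l u<v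

  code-<ʳ : (u : Fin n) {k l : Fin r} → k Fin.< l → code (u , k) < code (u , l)
  code-<ʳ u {k} {l} k<l = subst₂ _<_ (sym (toℕ-combine u k)) (sym (toℕ-combine u l)) (+-monoʳ-< (r * toℕ u) k<l)

  code-<ʳ⁻ : (u : Fin n) {k l : Fin r} → code (u , k) < code (u , l) → k Fin.< l
  code-<ʳ⁻ u {k} {l} lt = +-cancelˡ-< (r * toℕ u) _ _ (subst₂ _<_ (toℕ-combine u k) (toℕ-combine u l) lt)

  code-≤ˡ : {u v : Fin n} {k l : Fin r} → code (u , k) < code (v , l) → u Fin.≤ v
  code-≤ˡ lt = ≮⇒≥ λ v<u → <-asym lt (code-<ˡ v<u)

  decode : ∀ {i} → i < n * r → Fin n × Fin r
  decode i< = remQuot r (fromℕ< i<)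

  code-decode : ∀ {i} (i< : i < n * r) → code (decode i<) ≡ i
  code-decode i< = trans (cong toℕ (combine-remQuot {n} r (fromℕ< i<))) (toℕ-fromℕ< i<)

  -- Imposed on a configuration and on its inverse, this characterises the configurations of regular
  -- multigraphs: `associated-decreases` is one direction, `multiplicity-associated` the other.
  BlocksDecrease : (Fin n × Fin r → Fin n × Fin r) → Set
  BlocksDecrease f = ∀ u {k k′} → k Fin.< k′ → code (f (u , k′)) < code (f (u , k))

  Associated : Multigraph n → (Fin n × Fin r → Fin n × Fin r) → Set
  Associated G f = ∀ x y → f x ≡ y ⇔ AssociatedPair G x y

  pair-edge : ∀ {G : Multigraph n} {u v} {k l : Fin r} → AssociatedPair G (u , k) (v , l) → 1 ≤ G u v
  pair-edge (s , 1≤s , s≤t , _) = ≤-trans 1≤s s≤t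

  pair-swap : ∀ {G : Multigraph n} {x y : Fin n × Fin r} → AssociatedPair G x y → AssociatedPair (flip G) y x
  pair-swap {G} {u , k} {v , l} (s , 1≤s , s≤t , k≡ , l≡) =
    -- The two ends number parallel edges in opposite orders: copy s seen from `u` is copy t - s + 1
    -- seen from `v`.
    t ∸ s + 1 , m≤n+m 1 (t ∸ s) ,
    ≤-trans (+-monoʳ-≤ (t ∸ s) 1≤s) (≤-reflexive (m∸n+n≡m s≤t)) ,
    trans l≡ (+-assoc j (t ∸ s) 1) ,
    trans k≡ (trans (cong (i +_) (sym eq)) (sym (+-assoc i _ 1)))
    where
    t = G u v
    i = edgesAfterV G u v
    j = edgesAfterU G u v
    eq : t ∸ (t ∸ s + 1) + 1 ≡ s
    eq = begin
      t ∸ (t ∸ s + 1) + 1   ≡⟨ cong (_+ 1) (∸-+-assoc t (t ∸ s) 1) ⟨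
      t ∸ (t ∸ s) ∸ 1 + 1   ≡⟨ cong (λ s → s ∸ 1 + 1) (m∸[m∸n]≡n s≤t) ⟩
      s ∸ 1 + 1             ≡⟨ m∸n+n≡m 1≤s ⟩
      s                     ∎
      where open ≡-Reasoning

  -- In the block of `u` the edges to later vertices come first: the positions of uv′ end no later
  -- than `edgesAfterV G u v`, after which those of uv begin.
  pair-order : ∀ {G : Multigraph n} {u v v′} {k k′ l l′ : Fin r} →
    AssociatedPair G (u , k) (v , l) → AssociatedPair G (u , k′) (v′ , l′) → v Fin.< v′ → k′ Fin.< k
  pair-order {G} {u} {v} {v′} {k} {k′} (s , 1≤s , _ , k≡ , _) (s′ , _ , s′≤t , k′≡ , _) v<v′ = s≤s⁻¹ (begin-strict
    suc (toℕ k′)                       ≡⟨ k′≡ ⟩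
    edgesAfterV G u v′ + s′            ≤⟨ +-monoʳ-≤ (edgesAfterV G u v′) s′≤t ⟩
    edgesAfterV G u v′ + G u v′        ≤⟨ after-step (G u) v<v′ ⟩
    edgesAfterV G u v                  <⟨ m<m+n (edgesAfterV G u v) 1≤s ⟩
    edgesAfterV G u v + s              ≡⟨ k≡ ⟨
    suc (toℕ k)                        ∎)
    where open ≤-Reasoning

  pair-decreasing : ∀ {G : Multigraph n} {u k k′} {y y′ : Fin n × Fin r} →
    AssociatedPair G (u , k) y → AssociatedPair G (u , k′) y′ → k Fin.< k′ → code y′ < code y
  pair-decreasing {G} {u} {k} {k′} {v , l} {v′ , l′} pr@(s , _ , _ , k≡ , l≡) pr′@(s′ , _ , s′≤t , k′≡ , l′≡) k<k′
    with Fin.<-cmp v v′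
  ... | tri< v<v′ _ _ = contradiction k<k′ (<-asym (pair-order {G} pr pr′ v<v′))
  ... | tri> _ _ v′<v = code-<ˡ v′<v
  ... | tri≈ _ refl _ = code-<ʳ v (s≤s⁻¹ (subst₂ _<_ (sym l′≡) (sym l≡)
          (+-monoˡ-< 1 (+-monoʳ-< (edgesAfterU G u v)
            (∸-monoʳ-< (+-cancelˡ-< (edgesAfterV G u v) s s′ (subst₂ _<_ k≡ k′≡ (s≤s k<k′))) s′≤t)))))

  pair-unique : ∀ {G : Multigraph n} {x : Fin n × Fin r} {y y′} → AssociatedPair G x y → AssociatedPair G x y′ → y ≡ y′
  pair-unique {G} {u , k} {v , l} {v′ , l′} pr@(s , _ , _ , k≡ , l≡) pr′@(s′ , _ , _ , k′≡ , l′≡) with Fin.<-cmp v v′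
  ... | tri< v<v′ _ _ = contradiction (pair-order {G} pr pr′ v<v′) (<-irrefl refl)
  ... | tri> _ _ v′<v = contradiction (pair-order {G} pr′ pr v′<v) (<-irrefl refl)
  ... | tri≈ _ refl _ with refl ← +-cancelˡ-≡ (edgesAfterV G u v) s s′ (trans (sym k≡) k′≡) =
    cong (v ,_) (toℕ-injective (suc-injective (trans l≡ (sym l′≡))))

  edge-pair : ∀ {G : Multigraph n} → Regular r G → ∀ {u v} → 1 ≤ G u v →
    ∃[ k ] ∃[ l ] AssociatedPair {r = r} G (u , k) (v , l)
  edge-pair {G} (rows , columns) {u} {v} 1≤t =
    -- The copy s = 1, at 0-based positions i and j + (t - 1); regularity keeps both below `r`.
    fromℕ< i<r , fromℕ< j<r , 1 , ≤-refl , 1≤t ,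
    trans (cong suc (toℕ-fromℕ< i<r)) (+-comm 1 i) ,
    trans (cong suc (toℕ-fromℕ< j<r)) (+-comm 1 _)
    where
    t = G u v
    i = edgesAfterV G u v
    j = edgesAfterU G u v
    i<r : i < r
    i<r = begin-strict
      i      <⟨ m<m+n i 1≤t ⟩
      i + t  ≤⟨ after-total (G u) v ⟩
      _      ≡⟨ rows u ⟩
      r      ∎
      where open ≤-Reasoning
    j<r : j + (t ∸ 1) < r
    j<r = begin-strict
      j + (t ∸ 1)   <⟨ +-monoʳ-< j (∸-monoʳ-< z<s 1≤t) ⟩
      j + t         ≤⟨ after-total (λ u → G u v) u ⟩
      _             ≡⟨ columns v ⟩
      r             ∎
      where open ≤-Reasoning

  associated-decreases : ∀ {G : Multigraph n} {f} → Associated G f → BlocksDecrease f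
  associated-decreases {G} assoc u {k} {k′} = pair-decreasing {G}
    (Equivalence.to (assoc (u , k) _) refl) (Equivalence.to (assoc (u , k′) _) refl)

  associated-swap : ∀ {G : Multigraph n} (C : (Fin n × Fin r) ↔ (Fin n × Fin r)) →
    Associated G (Inverse.to C) → Associated (flip G) (Inverse.from C)
  associated-swap {G} C assoc y x = mk⇔
    (λ from≡ → pair-swap {G} (Equivalence.to (assoc x y) (trans (cong to (sym from≡)) (strictlyInverseˡ y))))
    (λ pr → trans (cong from (sym (Equivalence.from (assoc x y) (pair-swap {flip G} pr)))) (strictlyInverseʳ x))
    where open Inverse C

to⇒from : ∀ {A : Set} (C : A ↔ A) {x y} → Inverse.to C x ≡ y → Inverse.from C y ≡ x
to⇒from C {x} refl = Inverse.strictlyInverseʳ C x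

from⇒to : ∀ {A : Set} (C : A ↔ A) {x y} → Inverse.from C y ≡ x → Inverse.to C x ≡ y
from⇒to C {_} {y} refl = Inverse.strictlyInverseˡ C y

-- The multigraph obtained from a configuration by forgetting superscripts

module _ {n r : ℕ} where

  multiplicity : (Fin n × Fin r → Fin n × Fin r) → Multigraph n
  multiplicity f u v = Σᶠ (λ (k : Fin r) → when (proj₁ (f (u , k)) Fin.≟ v) 1)

  _≟ˣ_ : (x y : Fin n × Fin r) → Dec (x ≡ y)
  _≟ˣ_ = ≡-dec Fin._≟_ Fin._≟_

  -- Splitting an indicator over the copies of `v` brings sums over a block into the form of a
  -- double count of pairs, in which a configuration can be traded for its inverse.
  fibre-sum : ∀ (x : Fin n × Fin r) v → when (proj₁ x Fin.≟ v) 1 ≡ Σᶠ (λ l → when (x ≟ˣ (v , l)) 1)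
  fibre-sum (v′ , l′) v = go (v′ Fin.≟ v)
    where
    go : Dec (v′ ≡ v) → when (v′ Fin.≟ v) 1 ≡ Σᶠ (λ l → when ((v′ , l′) ≟ˣ (v , l)) 1)
    go (yes refl) = trans (when-yes (v Fin.≟ v) refl) (sym (trans
      (Σ-single l′ λ l l≢ → when-no ((v , l′) ≟ˣ (v , l)) (≢-sym l≢ ∘ ,-injectiveʳ))
      (when-yes ((v , l′) ≟ˣ (v , l′)) refl)))
    go (no ≢v) = trans (when-no (v′ Fin.≟ v) ≢v)
      (sym (Σ-zero λ l → when-no ((v′ , l′) ≟ˣ (v , l)) (≢v ∘ ,-injectiveˡ)))

  multiplicity-rows : ∀ f u → Σᶠ (multiplicity f u) ≡ r
  multiplicity-rows f u = begin
    Σᶠ (λ v → Σᶠ (λ k → when (proj₁ (f (u , k)) Fin.≟ v) 1)) ≡⟨ ∑-comm {n} {r} (λ v k → when (proj₁ (f (u , k)) Fin.≟ v) 1) ⟩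
    Σᶠ (λ k → Σᶠ (λ v → when (proj₁ (f (u , k)) Fin.≟ v) 1)) ≡⟨ Σ-cong {r} inner ⟩
    Σᶠ {r} (λ _ → 1)                                         ≡⟨ Σ-ones r ⟩
    r                                                        ∎
    where
    open ≡-Reasoning
    inner : ∀ k → Σᶠ (λ v → when (proj₁ (f (u , k)) Fin.≟ v) 1) ≡ 1
    inner k = trans
      (Σ-single (proj₁ (f (u , k))) λ v v≢ → when-no (proj₁ (f (u , k)) Fin.≟ v) (≢-sym v≢))
      (when-yes (proj₁ (f (u , k)) Fin.≟ proj₁ (f (u , k))) refl)

  module _ (f : Fin n × Fin r → Fin n × Fin r) (u : Fin n) where

    column : Fin r → Fin n
    column k = proj₁ (f (u , k))

    earlier later : Fin r → Fin n → ℕ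
    earlier k v = Σᶠ (λ (k′ : Fin r) → when (k′ Fin.<? k) (when (column k′ Fin.≟ v) 1))
    later   k v = Σᶠ (λ (k′ : Fin r) → when (k Fin.<? k′) (when (column k′ Fin.≟ v) 1))

    multiplicity-split : ∀ k {v} → column k ≡ v → multiplicity f u v ≡ earlier k v + 1 + later k v
    multiplicity-split k {v} refl = begin
      Σᶠ hits                                              ≡⟨ Σ-cong split ⟩
      Σᶠ (λ k′ → lt k′ + eq k′ + gt k′)                    ≡⟨ ∑-distrib-+ (λ k′ → lt k′ + eq k′) gt ⟩
      Σᶠ (λ k′ → lt k′ + eq k′) + Σᶠ gt                    ≡⟨ cong (_+ Σᶠ gt) (∑-distrib-+ lt eq) ⟩
      Σᶠ lt + Σᶠ eq + Σᶠ gt                                ≡⟨ cong (λ x → Σᶠ lt + x + Σᶠ gt) one ⟩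
      Σᶠ lt + 1 + Σᶠ gt                                    ∎
      where
      open ≡-Reasoning
      hits lt eq gt : Fin r → ℕ
      hits k′ = when (column k′ Fin.≟ v) 1
      lt k′ = when (k′ Fin.<? k) (hits k′)
      eq k′ = when (k′ Fin.≟ k) 1
      gt k′ = when (k Fin.<? k′) (hits k′)

      one : Σᶠ eq ≡ 1
      one = trans (Σ-single k λ k′ → when-no (k′ Fin.≟ k)) (when-yes (k Fin.≟ k) refl)

      split : ∀ k′ → hits k′ ≡ lt k′ + eq k′ + gt k′
      split k′ with Fin.<-cmp k′ k
      ... | tri< k′<k k′≢k k≮k′ rewrite when-yes (k′ Fin.<? k) {hits k′} k′<k
              | when-no (k′ Fin.≟ k) {1} k′≢k | when-no (k Fin.<? k′) {hits k′} k≮k′ =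
        sym (trans (+-identityʳ _) (+-identityʳ _))
      ... | tri≈ k′≮k refl k≮k′ rewrite when-no (k Fin.<? k) {hits k} k≮k′
              | when-yes (k Fin.≟ k) {1} refl | when-yes (column k Fin.≟ column k) {1} refl = refl
      ... | tri> k′≮k k′≢k k<k′ rewrite when-no (k′ Fin.<? k) {hits k′} k′≮k
              | when-no (k′ Fin.≟ k) {1} k′≢k | when-yes (k Fin.<? k′) {hits k′} k<k′ = refl

    module _ (decreases : BlocksDecrease f) where

      column-antitone : ∀ {k k′} → k Fin.< k′ → column k′ Fin.≤ column k
      column-antitone k<k′ = code-≤ˡ (decreases u k<k′)

      after-multiplicity : ∀ v → after (multiplicity f u) v ≡ Σᶠ (λ (k′ : Fin r) → when (v Fin.<? column k′) 1)
      after-multiplicity v = begin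
        Σᶠ (λ (v′ : Fin n) → when (v Fin.<? v′) (multiplicity f u v′))
          ≡⟨ Σ-cong (λ (v′ : Fin n) → when-Σ (v Fin.<? v′) (λ k′ → when (column k′ Fin.≟ v′) 1)) ⟩
        Σᶠ (λ (v′ : Fin n) → Σᶠ (λ (k′ : Fin r) → when (v Fin.<? v′) (when (column k′ Fin.≟ v′) 1)))
          ≡⟨ ∑-comm {n} {r} (λ v′ k′ → when (v Fin.<? v′) (when (column k′ Fin.≟ v′) 1)) ⟩
        Σᶠ (λ (k′ : Fin r) → Σᶠ (λ (v′ : Fin n) → when (v Fin.<? v′) (when (column k′ Fin.≟ v′) 1)))
          ≡⟨ Σ-cong {r} inner ⟩
        Σᶠ (λ (k′ : Fin r) → when (v Fin.<? column k′) 1) ∎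
        where
        open ≡-Reasoning
        inner : ∀ k′ → Σᶠ (λ (v′ : Fin n) → when (v Fin.<? v′) (when (column k′ Fin.≟ v′) 1)) ≡ when (v Fin.<? column k′) 1
        inner k′ = trans
          (Σ-single (column k′) λ v′ v′≢ → trans
            (cong (when (v Fin.<? v′)) (when-no (column k′ Fin.≟ v′) (≢-sym v′≢))) (when-zero (v Fin.<? v′)))
          (cong (when (v Fin.<? column k′)) (when-yes (column k′ Fin.≟ column k′) refl))

      -- The column is antitone along a block, so the positions before `k` are those going to
      -- vertices after `v` and the earlier ones going to `v` itself.
      position : ∀ k {v} → column k ≡ v → toℕ k ≡ after (multiplicity f u) v + earlier k v
      position k {v} refl = begin
        toℕ k                                                       ≡⟨ Σ-below k ⟨
        Σᶠ (λ (k′ : Fin r) → when (k′ Fin.<? k) 1)                  ≡⟨ Σ-cong split ⟩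
        Σᶠ (λ k′ → above k′ + same k′)                              ≡⟨ ∑-distrib-+ above same ⟩
        Σᶠ above + Σᶠ same                                          ≡⟨ cong (_+ Σᶠ same) (after-multiplicity v) ⟨
        after (multiplicity f u) v + earlier k v                    ∎
        where
        open ≡-Reasoning
        above same : Fin r → ℕ
        -- No restriction to positions before `k`: antitonicity confines these to such positions.
        above k′ = when (v Fin.<? column k′) 1
        same  k′ = when (k′ Fin.<? k) (when (column k′ Fin.≟ v) 1)

        split : ∀ k′ → when (k′ Fin.<? k) 1 ≡ above k′ + same k′
        split k′ with k′ Fin.<? k
        split k′ | yes k′<k with Fin.<-cmp (column k) (column k′)
        ... | tri< v<c v≢c _ rewrite when-yes (column k Fin.<? column k′) {1} v<c
                | when-no (column k′ Fin.≟ column k) {1} (≢-sym v≢c) = refl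
        ... | tri≈ v≮c v≡c _ rewrite when-no (column k Fin.<? column k′) {1} v≮c
                | when-yes (column k′ Fin.≟ column k) {1} (sym v≡c) = refl
        ... | tri> _ _ c<v = contradiction (column-antitone k′<k) (<⇒≱ c<v)
        split k′ | no k′≮k = sym (trans (+-identityʳ _) (when-no (column k Fin.<? column k′) {1} not-above))
          where
          not-above : ¬ column k Fin.< column k′
          not-above v<c with Fin.<-cmp k k′
          ... | tri< k<k′ _ _ = <⇒≱ v<c (column-antitone k<k′)
          ... | tri≈ _ refl _ = <-irrefl refl v<c
          ... | tri> _ _ k′<k = k′≮k k′<k

  multiplicity-swap : ∀ (C : (Fin n × Fin r) ↔ (Fin n × Fin r)) u v →
    multiplicity (Inverse.to C) u v ≡ multiplicity (Inverse.from C) v u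
  multiplicity-swap C u v = begin
    Σᶠ (λ k → when (proj₁ (to (u , k)) Fin.≟ v) 1)                 ≡⟨ Σ-cong {r} (λ k → fibre-sum (to (u , k)) v) ⟩
    Σᶠ (λ k → Σᶠ (λ l → when (to (u , k) ≟ˣ (v , l)) 1))           ≡⟨ ∑-comm {r} {r} (λ k l → when (to (u , k) ≟ˣ (v , l)) 1) ⟩
    Σᶠ (λ l → Σᶠ (λ k → when (to (u , k) ≟ˣ (v , l)) 1))           ≡⟨ Σ-cong {r} (λ l → Σ-cong {r} λ k →
                                                                     when-⇔ (to (u , k) ≟ˣ (v , l)) (from (v , l) ≟ˣ (u , k))
                                                                       (to⇒from C) (from⇒to C)) ⟩
    Σᶠ (λ l → Σᶠ (λ k → when (from (v , l) ≟ˣ (u , k)) 1))         ≡⟨ Σ-cong {r} (λ l → fibre-sum (from (v , l)) u) ⟨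
    Σᶠ (λ l → when (proj₁ (from (v , l)) Fin.≟ u) 1)               ∎
    where
    open Inverse C
    open ≡-Reasoning

  multiplicity-regular : ∀ (C : (Fin n × Fin r) ↔ (Fin n × Fin r)) → Regular r (multiplicity (Inverse.to C))
  multiplicity-regular C = multiplicity-rows to ,
    λ v → trans (Σ-cong λ u → multiplicity-swap C u v) (multiplicity-rows from v)
    where open Inverse C

  module _ (C : (Fin n × Fin r) ↔ (Fin n × Fin r))
           (to-decreases : BlocksDecrease (Inverse.to C)) (from-decreases : BlocksDecrease (Inverse.from C)) where

    open Inverse C using (to; from)

    -- Both counts run over the pairs joining the two blocks, and on these pairs the configuration
    -- reverses the order of superscripts. This is the source of the term t - s in the associated
    -- configuration.
    later-earlier : ∀ {u k v l} → to (u , k) ≡ (v , l) → later to u k v ≡ earlier from v l u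
    later-earlier {u} {k} {v} {l} to≡ = begin
      Σᶠ (λ (k′ : Fin r) → when (k Fin.<? k′) (when (proj₁ (to (u , k′)) Fin.≟ v) 1))
        ≡⟨ Σ-cong {r} (λ k′ → trans (cong (when (k Fin.<? k′)) (fibre-sum (to (u , k′)) v)) (when-Σ (k Fin.<? k′) {r} _)) ⟩
      Σᶠ (λ (k′ : Fin r) → Σᶠ (λ (l′ : Fin r) → when (k Fin.<? k′) (when (to (u , k′) ≟ˣ (v , l′)) 1)))
        ≡⟨ ∑-comm {r} {r} (λ k′ l′ → when (k Fin.<? k′) (when (to (u , k′) ≟ˣ (v , l′)) 1)) ⟩
      Σᶠ (λ (l′ : Fin r) → Σᶠ (λ (k′ : Fin r) → when (k Fin.<? k′) (when (to (u , k′) ≟ˣ (v , l′)) 1)))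
        ≡⟨ Σ-cong {r} (λ l′ → Σ-cong {r} λ k′ → exchange k′ l′) ⟩
      Σᶠ (λ (l′ : Fin r) → Σᶠ (λ (k′ : Fin r) → when (l′ Fin.<? l) (when (from (v , l′) ≟ˣ (u , k′)) 1)))
        ≡⟨ Σ-cong {r} (λ l′ → trans (cong (when (l′ Fin.<? l)) (fibre-sum (from (v , l′)) u)) (when-Σ (l′ Fin.<? l) {r} _)) ⟨
      Σᶠ (λ (l′ : Fin r) → when (l′ Fin.<? l) (when (proj₁ (from (v , l′)) Fin.≟ u) 1)) ∎
      where
      open ≡-Reasoning
      exchange : ∀ k′ l′ → when (k Fin.<? k′) (when (to (u , k′) ≟ˣ (v , l′)) 1) ≡
                           when (l′ Fin.<? l) (when (from (v , l′) ≟ˣ (u , k′)) 1)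
      exchange k′ l′ with to (u , k′) ≟ˣ (v , l′)
      ... | yes to≡′ rewrite when-yes (from (v , l′) ≟ˣ (u , k′)) {1} (to⇒from C to≡′) =
        when-⇔ (k Fin.<? k′) (l′ Fin.<? l)
          (λ k<k′ → code-<ʳ⁻ v (subst₂ (λ y y′ → code y < code y′) to≡′ to≡ (to-decreases u k<k′)))
          (λ l′<l → code-<ʳ⁻ u (subst₂ (λ x x′ → code x < code x′) (to⇒from C to≡) (to⇒from C to≡′) (from-decreases v l′<l)))
      ... | no ≢ rewrite when-no (from (v , l′) ≟ˣ (u , k′)) {1}
                   (≢ ∘ from⇒to C) =
        trans (when-zero (k Fin.<? k′)) (sym (when-zero (l′ Fin.<? l)))

    to-pair : ∀ {u k v l} → to (u , k) ≡ (v , l) → AssociatedPair (multiplicity to) (u , k) (v , l)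
    to-pair {u} {k} {v} {l} to≡ =
      -- s is the number of this copy of uv in the order of the block of `u`.
      earlier to u k v + 1 , m≤n+m 1 _ ,
      ≤-trans (m≤m+n _ _) (≤-reflexive (sym split)) ,
      k-position , l-position
      where
      open ≡-Reasoning
      split : multiplicity to u v ≡ earlier to u k v + 1 + later to u k v
      split = multiplicity-split to u k (cong proj₁ to≡)

      i = edgesAfterV (multiplicity to) u v
      j = edgesAfterU (multiplicity to) u v

      k-position : suc (toℕ k) ≡ i + (earlier to u k v + 1)
      k-position = begin
        suc (toℕ k)                     ≡⟨ +-comm 1 (toℕ k) ⟩
        toℕ k + 1                       ≡⟨ cong (_+ 1) (position to u to-decreases k (cong proj₁ to≡)) ⟩
        i + earlier to u k v + 1        ≡⟨ +-assoc i _ 1 ⟩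
        i + (earlier to u k v + 1)      ∎

      rest : multiplicity to u v ∸ (earlier to u k v + 1) ≡ later to u k v
      rest = trans (cong (_∸ (earlier to u k v + 1)) split) (m+n∸m≡n (earlier to u k v + 1) _)

      after-swap : j ≡ after (multiplicity from v) u
      after-swap = Σ-cong λ (u′ : Fin n) → cong (when (u Fin.<? u′)) (multiplicity-swap C u′ v)

      l-position : suc (toℕ l) ≡ j + (multiplicity to u v ∸ (earlier to u k v + 1)) + 1
      l-position = begin
        suc (toℕ l)                                             ≡⟨ +-comm 1 (toℕ l) ⟩
        toℕ l + 1                                               ≡⟨ cong (_+ 1) (position from v from-decreases l (cong proj₁ (to⇒from C to≡))) ⟩
        after (multiplicity from v) u + earlier from v l u + 1  ≡⟨ cong₂ (λ a b → a + b + 1) after-swap (trans rest (later-earlier to≡)) ⟨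
        j + (multiplicity to u v ∸ (earlier to u k v + 1)) + 1  ∎

    multiplicity-associated : Associated (multiplicity to) to
    multiplicity-associated x y = mk⇔ to-pair
      (λ pr → pair-unique {G = multiplicity to} {x} (to-pair refl) pr)

preimage : ∀ {A B : Set} (f : A → B) {ys} → All (λ y → ∃[ x ] f x ≡ y) ys → ∃[ xs ] map f xs ≡ ys
preimage f []                  = [] , refl
preimage f ((x , refl) ∷ rest) with xs , refl ← preimage f rest = x ∷ xs , refl

-- Planar matchings and increasing subsequences of positions

module _ {n r : ℕ} where

  -- The value 0 beyond the last position is a default.
  onCodes : (Fin n × Fin r → Fin n × Fin r) → ℕ → ℕ
  onCodes f i with i <? n * r
  ... | yes i< = code (f (decode i<))
  ... | no _   = 0

  onCodes-code : ∀ f x → onCodes f (code x) ≡ code (f x)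
  onCodes-code f x with code x <? n * r
  ... | yes x< = cong (code ∘ f) (code-injective (code-decode {n} {r} x<))
  ... | no x≮  = contradiction (code<n*r x) x≮

  on-codes : ∀ (P : ℕ → Set) → (∀ (x : Fin n × Fin r) → P (code x)) → ∀ {i} → i < n * r → P i
  on-codes P all i< = subst P (code-decode {n} {r} i<) (all (decode i<))

  configuration-diagram : (C : (Fin n × Fin r) ↔ (Fin n × Fin r)) →
    Diagram (n * r) (onCodes (Inverse.to C)) (onCodes (Inverse.from C))
  configuration-diagram C = Forward.diagram (onCodes to) (onCodes from)
    (bounded to) (bounded from) (inverse-on strictlyInverseʳ) (inverse-on strictlyInverseˡ)
    where
    open Inverse C
    bounded : ∀ f {i} → i < n * r → onCodes f i < n * r
    bounded f = on-codes (λ i → onCodes f i < n * r)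
      λ x → subst (_< n * r) (sym (onCodes-code f x)) (code<n*r (f x))
    inverse-on : ∀ {f g} → (∀ x → g (f x) ≡ x) → ∀ {i} → i < n * r → onCodes g (onCodes f i) ≡ i
    inverse-on {f} {g} gf = on-codes (λ i → onCodes g (onCodes f i) ≡ i) λ x →
      trans (cong (onCodes g) (onCodes-code f x)) (trans (onCodes-code g (f x)) (cong code (gf x)))

  code-suc : ∀ (u : Fin n) {s s′ : Fin r} → toℕ s′ ≡ suc (toℕ s) → code (u , s′) ≡ suc (code (u , s))
  code-suc u {s} {s′} eq = begin
    toℕ (combine u s′)            ≡⟨ toℕ-combine u s′ ⟩
    r * toℕ u + toℕ s′            ≡⟨ cong (r * toℕ u +_) eq ⟩
    r * toℕ u + suc (toℕ s)       ≡⟨ +-suc (r * toℕ u) (toℕ s) ⟩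
    suc (r * toℕ u + toℕ s)       ≡⟨ cong suc (toℕ-combine u s) ⟨
    suc (toℕ (combine u s))       ∎
    where open ≡-Reasoning

  adjacent-decrease : ∀ f →
    (∀ u {s s′} → toℕ s′ ≡ suc (toℕ s) → code (f (u , s′)) < code (f (u , s))) → BlocksDecrease f
  adjacent-decrease f adjacent u {k} {k′} k<k′ = go (toℕ k′ ∸ suc (toℕ k)) k′ (sym (m∸n+n≡m k<k′))
    where
    go : ∀ e k′ → toℕ k′ ≡ e + suc (toℕ k) → code (f (u , k′)) < code (f (u , k))
    go zero    k′ eq = adjacent u {k} {k′} eq
    go (suc e) k′ eq = <-trans {j = code {n} {r} (f (u , fromℕ< k″<r))} (adjacent u {fromℕ< k″<r} {k′} (trans eq (cong suc (sym (toℕ-fromℕ< k″<r)))))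
                               (go e (fromℕ< k″<r) (toℕ-fromℕ< k″<r))
      where
      k″<r : e + suc (toℕ k) < r
      k″<r = ≤-trans (≤-reflexive (sym eq)) (<⇒≤ (toℕ<n k′))

  module _ (C : (Fin n × Fin r) ↔ (Fin n × Fin r)) {τ : ℕ → ℕ}
           (D : Diagram (n * r) (onCodes (Inverse.to C)) τ)
           {G : Multigraph n} (regular : Regular r G) (assoc : Associated G (Inverse.to C)) where

    open Inverse C using (to)

    edge : Fin n × Fin r → Fin n × Fin n
    edge x = proj₁ x , proj₁ (to x)

    edge-present : ∀ x → 1 ≤ uncurry G (edge x)
    edge-present x = pair-edge {G = G} (Equivalence.to (assoc x (to x)) refl)

    present-edge : ∀ {e} → 1 ≤ uncurry G e → ∃[ x ] edge x ≡ e
    present-edge {u , v} 1≤G with k , l , pr ← edge-pair {G = G} regular 1≤G =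
      (u , k) , cong (λ y → u , proj₁ y) (Equivalence.from (assoc (u , k) (v , l)) pr)

    -- A common U-end would contradict the decrease of `to` within a block, a common V-end the
    -- decrease of its inverse.
    below-edges : ∀ {x x′} → code x < code x′ → code (to x) < code (to x′) →
                  proj₁ x Fin.< proj₁ x′ × proj₁ (to x) Fin.< proj₁ (to x′)
    below-edges {u , k} {u′ , k′} x<x′ y<y′ = ≤∧≢⇒< (code-≤ˡ x<x′) u≢u′ , ≤∧≢⇒< (code-≤ˡ y<y′) (v≢v′ refl refl)
      where
      u≢u′ : toℕ u ≢ toℕ u′
      u≢u′ eq with refl ← toℕ-injective eq =
        <-asym y<y′ (associated-decreases {G = G} assoc u (code-<ʳ⁻ u x<x′))

      v≢v′ : ∀ {y y′} → to (u , k) ≡ y → to (u′ , k′) ≡ y′ → toℕ (proj₁ y) ≢ toℕ (proj₁ y′)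
      v≢v′ {v , l} {v′ , l′} y≡ y′≡ eq with refl ← toℕ-injective eq =
        <-asym x<x′ (subst₂ (λ x x′ → code x′ < code x) (to⇒from C y≡) (to⇒from C y′≡)
          (associated-decreases {G = flip G} (associated-swap {G = G} C assoc) v
            (code-<ʳ⁻ v (subst₂ (λ y y′ → code y < code y′) y≡ y′≡ y<y′))))

    below⇒noncrossing : ∀ {x x′} → Below D (code x′) (code x) → Noncrossing (edge x) (edge x′)
    below⇒noncrossing {x} {x′} (x′<x , y′<y) =
      inj₂ (below-edges x′<x (subst₂ _<_ (onCodes-code to x′) (onCodes-code to x) y′<y))

    -- Strict order at both ends survives every choice of superscripts, so any chosen copies of
    -- noncrossing edges are comparable points.
    noncrossing⇒ranks : ∀ {x x′} → Noncrossing (edge x) (edge x′) → rank D (code x) ≢ rank D (code x′)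
    noncrossing⇒ranks {x} {x′} nc = case nc
      where
      below : ∀ {x x′} → proj₁ x Fin.< proj₁ x′ × proj₁ (to x) Fin.< proj₁ (to x′) → Below D (code x) (code x′)
      below {x} {x′} (u<u′ , v<v′) = code-<ˡ u<u′ ,
        subst₂ _<_ (sym (onCodes-code to x)) (sym (onCodes-code to x′)) (code-<ˡ v<v′)
      case : Noncrossing (edge x) (edge x′) → rank D (code x) ≢ rank D (code x′)
      case (inj₁ lt) = <⇒≢ (rank-mono D (code<n*r x′) (below lt))
      case (inj₂ gt) = ≢-sym (<⇒≢ (rank-mono D (code<n*r x) (below gt)))

    longest-matching : ∃[ es ] PlanarMatching G es × length es ≡ width D
    longest-matching with ks , chain , inside , len ← longest D (n * r) (n * r) ≤-refl ≤-refl
      with xs , refl ← preimage (code {n} {r}) (All.map (λ (k< , _) → decode k< , code-decode {n} {r} k<) inside) =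
      map edge xs ,
      (All.map⁺ (All.universal edge-present xs) ,
       AllPairs.map⁺ (AllPairs.map (λ {x} {x′} → below⇒noncrossing {x} {x′}) (AllPairs.map⁻ chain))) ,
      trans (length-map edge xs) (trans (sym (length-map code xs)) len)

    matching-bound : ∀ es → PlanarMatching G es → length es ≤ width D
    matching-bound es (present , noncrossing) with xs , refl ← preimage edge (All.map present-edge present) =
      subst (_≤ width D) (sym (length-map edge xs))
        (distinct-length (rank D ∘ code) (All.universal (λ x → rank-bound D (code<n*r x)) xs)
          (AllPairs.map (λ {x} {x′} → noncrossing⇒ranks {x} {x′}) (AllPairs.map⁻ noncrossing)))

    width-maximal : MaxPlanarMatching G (width D)
    width-maximal = longest-matching , matching-bound

-- Walks

word : ∀ {d m} → Vec (Fin d) m → ℕ → ℕ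
word []       _       = 0
word (a ∷ as) zero    = toℕ a
word (a ∷ as) (suc k) = word as k

word-lookup : ∀ {d m} (as : Vec (Fin d) m) i → word as (toℕ i) ≡ toℕ (lookup as i)
word-lookup (a ∷ as) Fin.zero    = refl
word-lookup (a ∷ as) (Fin.suc i) = word-lookup as i

word-bound : ∀ {d m} (as : Vec (Fin d) m) {k} → k < m → word as k < d
word-bound (a ∷ as) {zero}  _         = toℕ<n a
word-bound (a ∷ as) {suc k} (s≤s k<m) = word-bound as k<m

word-injective : ∀ {d m} (as bs : Vec (Fin d) m) → (∀ {k} → k < m → word as k ≡ word bs k) → as ≡ bs
word-injective []       []       _  = refl
word-injective (a ∷ as) (b ∷ bs) eq = cong₂ _∷_ (toℕ-injective (eq z<s)) (word-injective as bs (eq ∘ s≤s))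

vector : ∀ {d} m (w : ℕ → ℕ) → (∀ {k} → k < m → w k < d) → Vec (Fin d) m
vector zero    w w<d = []
vector (suc m) w w<d = fromℕ< (w<d z<s) ∷ vector m (w ∘ suc) (w<d ∘ s≤s)

word-vector : ∀ {d} m w (w<d : ∀ {k} → k < m → w k < d) → ∀ {k} → k < m → word (vector m w w<d) k ≡ w k
word-vector (suc m) w w<d {zero}  _         = toℕ-fromℕ< (w<d z<s)
word-vector (suc m) w w<d {suc k} (s≤s k<m) = word-vector m (w ∘ suc) (w<d ∘ s≤s) k<m

count-head : ∀ w k c → count w (suc k) c ≡ δ (w 0) c + count (w ∘ suc) k c
count-head w zero    c = sym (+-identityʳ _)
count-head w (suc k) c = trans (cong (_+ δ (w (suc k)) c) (count-head w k c)) (+-assoc (δ (w 0) c) _ _)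

unit-δ : ∀ {d} (a i : Fin d) → unit a i ≡ ℤ.+ δ (toℕ a) (toℕ i)
unit-δ a i with a Fin.≟ i
... | yes refl = cong ℤ.+_ (sym (δ-refl (toℕ a)))
... | no a≢i   = cong ℤ.+_ (sym (δ-≢ (a≢i ∘ toℕ-injective)))

_≗ᴾ_ : ∀ {d} → Point d → Point d → Set
x ≗ᴾ y = ∀ i → x i ≡ y i

region-cong : ∀ {d} {x y : Point d} → x ≗ᴾ y → Region d x → Region d y
region-cong eq reg i i′ i′≡ = subst₂ ℤ._≤_ (eq i′) (eq i) (reg i i′ i′≡)

shift : ∀ {d} → Point d → (ℕ → ℕ) → ℕ → Point d
shift x w k i = x i ℤ.+ ℤ.+ count w k (toℕ i)

shift-step : ∀ {d m} (x : Point d) a (as : Vec (Fin d) m) k →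
  shift (move x (+e a)) (word as) k ≗ᴾ shift x (word (a ∷ as)) (suc k)
shift-step x a as k i = begin
  x i ℤ.+ unit a i ℤ.+ ℤ.+ count (word as) k (toℕ i)
    ≡⟨ cong (λ e → x i ℤ.+ e ℤ.+ ℤ.+ count (word as) k (toℕ i)) (unit-δ a i) ⟩
  x i ℤ.+ ℤ.+ δ (toℕ a) (toℕ i) ℤ.+ ℤ.+ count (word as) k (toℕ i)
    ≡⟨ ℤ.+-assoc (x i) _ _ ⟩
  x i ℤ.+ ℤ.+ (δ (toℕ a) (toℕ i) + count (word as) k (toℕ i))
    ≡⟨ cong (λ c → x i ℤ.+ ℤ.+ c) (count-head (word (a ∷ as)) k (toℕ i)) ⟨
  x i ℤ.+ ℤ.+ count (word (a ∷ as)) (suc k) (toℕ i) ∎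
  where open ≡-Reasoning

foldl-+e : ∀ {d m} (x : Point d) (as : Vec (Fin d) m) →
  foldl move x (map +e (toList as)) ≗ᴾ shift x (word as) m
foldl-+e x []       i = sym (ℤ.+-identityʳ (x i))
foldl-+e {m = suc m} x (a ∷ as) i = trans (foldl-+e (move x (+e a)) as i) (shift-step x a as m i)

foldl-e : ∀ {d m} (x : Point d) (bs : Vec (Fin d) m) → ∀ i →
  foldl move x (map -e (toList bs)) i ≡ x i ℤ.- ℤ.+ count (word bs) m (toℕ i)
foldl-e x []       i = sym (ℤ.+-identityʳ (x i))
foldl-e {m = suc m} x (b ∷ bs) i = begin
  foldl move (move x (-e b)) (map -e (toList bs)) i            ≡⟨ foldl-e (move x (-e b)) bs i ⟩
  x i ℤ.- unit b i ℤ.- ℤ.+ rest                                ≡⟨ cong (λ e → x i ℤ.- e ℤ.- ℤ.+ rest) (unit-δ b i) ⟩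
  x i ℤ.- ℤ.+ first ℤ.- ℤ.+ rest                               ≡⟨ ℤ.+-assoc (x i) _ _ ⟩
  x i ℤ.+ (ℤ.- ℤ.+ first ℤ.- ℤ.+ rest)                         ≡⟨ cong (λ e → x i ℤ.+ e) (ℤ.neg-distrib-+ (ℤ.+ first) (ℤ.+ rest)) ⟨
  x i ℤ.- ℤ.+ (first + rest)                                   ≡⟨ cong (λ c → x i ℤ.- ℤ.+ c) (count-head (word (b ∷ bs)) m (toℕ i)) ⟨
  x i ℤ.- ℤ.+ count (word (b ∷ bs)) (suc m) (toℕ i)            ∎
  where
  open ≡-Reasoning
  first = δ (toℕ b) (toℕ i)
  rest  = count (word bs) m (toℕ i)

stays⇒ : ∀ {d m} (x : Point d) (as : Vec (Fin d) m) →
  All (Region d) (scanl move x (map +e (toList as))) → ∀ {k} → k ≤ m → Region d (shift x (word as) k)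
stays⇒ x []       (reg ∷ _)    z≤n       = region-cong (λ i → sym (ℤ.+-identityʳ (x i))) reg
stays⇒ x (a ∷ as) (reg ∷ _)    z≤n       = region-cong (λ i → sym (ℤ.+-identityʳ (x i))) reg
stays⇒ x (a ∷ as) (_   ∷ regs) {suc k} (s≤s k≤m) =
  region-cong (shift-step x a as k) (stays⇒ (move x (+e a)) as regs k≤m)

stays⇐ : ∀ {d m} (x : Point d) (as : Vec (Fin d) m) →
  (∀ {k} → k ≤ m → Region d (shift x (word as) k)) → All (Region d) (scanl move x (map +e (toList as)))
stays⇐ x []       reg = region-cong (λ i → ℤ.+-identityʳ (x i)) (reg z≤n) ∷ []
stays⇐ x (a ∷ as) reg = region-cong (λ i → ℤ.+-identityʳ (x i)) (reg z≤n) ∷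
  stays⇐ (move x (+e a)) as (λ {k} k≤m → region-cong (λ i → sym (shift-step x a as k i)) (reg (s≤s k≤m)))

stays⇔lattice : ∀ {d m} (as : Vec (Fin d) m) →
  All (Region d) (scanl move origin (map +e (toList as))) ⇔ Lattice m (word as)
stays⇔lattice {d} {m} as = mk⇔ ⇒ ⇐
  where
  w = word as
  ⇒ : All (Region d) (scanl move origin (map +e (toList as))) → Lattice m w
  ⇒ regs {k} k≤m c with suc c <? d
  -- Lattice words are tested at all rows, the region in `d` coordinates only; beyond these no
  -- letter occurs and the count is 0.
  ... | no 1+c≮d = ≤-trans (≤-reflexive (count-zero w k (suc c)
          λ i<k wi≡ → 1+c≮d (subst (_< d) wi≡ (word-bound as (<-≤-trans i<k k≤m))))) z≤n
  ... | yes 1+c<d = subst₂ (λ a b → count w k a ≤ count w k b) (toℕ-fromℕ< 1+c<d) (toℕ-fromℕ< c<d)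
          (ℤ.drop‿+≤+ (subst₂ ℤ._≤_ (ℤ.+-identityˡ _) (ℤ.+-identityˡ _)
            (stays⇒ origin as regs k≤m (fromℕ< c<d) (fromℕ< 1+c<d)
              (trans (toℕ-fromℕ< 1+c<d) (cong suc (sym (toℕ-fromℕ< c<d)))))))
    where
    c<d : c < d
    c<d = <-trans (n<1+n c) 1+c<d
  ⇐ : Lattice m w → All (Region d) (scanl move origin (map +e (toList as)))
  ⇐ lat = stays⇐ origin as λ {k} k≤m i i′ i′≡ →
    ℤ.+-monoʳ-≤ 0ℤ (+≤+ (subst (λ c → count w k c ≤ count w k (toℕ i)) (sym i′≡) (lat k≤m (toℕ i))))

scanl-++ : ∀ {A B : Set} {P : A → Set} (f : A → B → A) x ys zs →
  All P (scanl f x (ys ++ zs)) ⇔ (All P (scanl f x ys) × All P (scanl f (foldl f x ys) zs))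
scanl-++ f x []       []       = mk⇔ (λ { (p ∷ []) → p ∷ [] , p ∷ [] }) proj₂
scanl-++ f x []       (z ∷ zs) = mk⇔ (λ { (p ∷ ps) → p ∷ [] , p ∷ ps }) proj₂
scanl-++ f x (y ∷ ys) zs = mk⇔
  (λ { (p ∷ ps) → let (l , r) = Equivalence.to (scanl-++ f (f x y) ys zs) ps in p ∷ l , r })
  (λ { (p ∷ l , r) → p ∷ Equivalence.from (scanl-++ f (f x y) ys zs) (l , r) })

map-reverse-∷ : ∀ {d} (b : Fin d) bs →
  map -e (List.reverse (b ∷ bs)) ≡ map -e (List.reverse bs) ++ -e b ∷ []
map-reverse-∷ b bs = trans (cong (map -e) (unfold-reverse b bs)) (map-++ -e (List.reverse bs) (b ∷ []))

return : ∀ {d} {x : Point d} y bs → x ≗ᴾ foldl move y (map +e bs) →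
  foldl move x (map -e (List.reverse bs)) ≗ᴾ y
return y []       eq i = eq i
return {x = x} y (b ∷ bs) eq i = begin
  foldl move x (map -e (List.reverse (b ∷ bs))) i             ≡⟨ cong (λ ss → foldl move x ss i) (map-reverse-∷ b bs) ⟩
  foldl move x (map -e (List.reverse bs) ++ -e b ∷ []) i      ≡⟨ cong (λ z → z i) (foldl-++ move x (map -e (List.reverse bs)) _) ⟩
  foldl move x (map -e (List.reverse bs)) i ℤ.- unit b i      ≡⟨ cong (ℤ._- unit b i) (return (move y (+e b)) bs eq i) ⟩
  y i ℤ.+ unit b i ℤ.- unit b i                               ≡⟨ ℤ.+-assoc (y i) _ _ ⟩
  y i ℤ.+ (unit b i ℤ.- unit b i)                             ≡⟨ cong (λ e → y i ℤ.+ e) (ℤ.+-inverseʳ (unit b i)) ⟩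
  y i ℤ.+ 0ℤ                                                  ≡⟨ ℤ.+-identityʳ (y i) ⟩
  y i                                                         ∎
  where open ≡-Reasoning

-- The reversed negative steps visit backwards the very points that the positive steps `bs` visit
-- from `y`. So the second half of the walk is governed by a lattice condition too.
retrace : ∀ {d} {x : Point d} y bs → x ≗ᴾ foldl move y (map +e bs) →
  All (Region d) (scanl move x (map -e (List.reverse bs))) ⇔ All (Region d) (scanl move y (map +e bs))
retrace y [] eq = mk⇔ (λ { (p ∷ []) → region-cong eq p ∷ [] }) (λ { (p ∷ []) → region-cong (sym ∘ eq) p ∷ [] })
retrace {d} {x} y (b ∷ bs) eq rewrite map-reverse-∷ b bs = mk⇔
  (λ regs → let (l , r) = Equivalence.to (scanl-++ move x back (-e b ∷ [])) regs in
            region-cong last (All.head (All.tail r)) ∷ Equivalence.to IH l)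
  (λ { (p ∷ ps) → Equivalence.from (scanl-++ move x back (-e b ∷ []))
         (Equivalence.from IH ps ,
          region-cong (sym ∘ before-last) (head ps) ∷ region-cong (sym ∘ last) p ∷ []) })
  where
  back = map -e (List.reverse bs)
  IH = retrace (move y (+e b)) bs eq
  before-last : foldl move x back ≗ᴾ move y (+e b)
  before-last = return (move y (+e b)) bs eq
  last : move (foldl move x back) (-e b) ≗ᴾ y
  last i = trans (cong (λ z → z i) (sym (foldl-++ move x back (-e b ∷ []))))
    (trans (cong (λ ss → foldl move x ss i) (sym (map-reverse-∷ b bs))) (return y (b ∷ bs) eq i))
  head : ∀ {x : Point d} {ss} → All (Region d) (scanl move x ss) → Region d x
  head {ss = []}    (p ∷ _) = p
  head {ss = _ ∷ _} (p ∷ _) = p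

endpoint-count : ∀ {d m} (a b : Vec (Fin d) m) i →
  endpoint (a ∣ b) i ≡ ℤ.+ count (word a) m (toℕ i) ℤ.- ℤ.+ count (word b) m (toℕ i)
endpoint-count {m = m} a b i = begin
  foldl move origin (up ++ down) i                              ≡⟨ cong (λ z → z i) (foldl-++ move origin up down) ⟩
  foldl move (foldl move origin up) down i                      ≡⟨ foldl-e (foldl move origin up) b i ⟩
  foldl move origin up i ℤ.- ℤ.+ B                              ≡⟨ cong (ℤ._- ℤ.+ B) (foldl-+e origin a i) ⟩
  0ℤ ℤ.+ ℤ.+ count (word a) m (toℕ i) ℤ.- ℤ.+ B                 ≡⟨ cong (ℤ._- ℤ.+ B) (ℤ.+-identityˡ (ℤ.+ count (word a) m (toℕ i))) ⟩
  ℤ.+ count (word a) m (toℕ i) ℤ.- ℤ.+ B                        ∎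
  where
  open ≡-Reasoning
  up   = map +e (toList a)
  down = map -e (toList b)
  B    = count (word b) m (toℕ i)

closed⇔content : ∀ {d m} (a b : Vec (Fin d) m) →
  W* d m origin (a ∣ b) ⇔ (∀ c → count (word a) m c ≡ count (word b) m c)
closed⇔content {d} {m} a b = mk⇔ ⇒
  (λ content i → trans (endpoint-count a b i) (ℤ.i≡j⇒i-j≡0 (cong ℤ.+_ (content (toℕ i)))))
  where
  none : ∀ (as : Vec (Fin d) m) {c} → ¬ c < d → count (word as) m c ≡ 0
  none as c≮d = count-zero (word as) m _ λ k<m wk≡c → c≮d (subst (_< d) wk≡c (word-bound as k<m))
  ⇒ : W* d m origin (a ∣ b) → ∀ c → count (word a) m c ≡ count (word b) m c
  ⇒ closed c with c <? d
  ... | no c≮d  = trans (none a c≮d) (sym (none b c≮d))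
  ... | yes c<d = subst (λ c → count (word a) m c ≡ count (word b) m c) (toℕ-fromℕ< c<d)
    (ℤ.+-injective (ℤ.i-j≡0⇒i≡j _ _ (trans (sym (endpoint-count a b (fromℕ< c<d))) (closed (fromℕ< c<d)))))

-- Equal content means that `a` and `b` lead from the origin to the same turning point, as `retrace`
-- requires.
tilde-stays⇔lattices : ∀ {d m} (a b : Vec (Fin d) m) → (∀ c → count (word a) m c ≡ count (word b) m c) →
  StaysIn (Region d) (tilde (a ∣ b)) ⇔ (Lattice m (word a) × Lattice m (word b))
tilde-stays⇔lattices {d} {m} a b content rewrite toList-reverse b = mk⇔ {B = Lattice m (word a) × Lattice m (word b)}
  (λ stays → let (l , r) = Equivalence.to split stays in
    Equivalence.to (stays⇔lattice a) l , Equivalence.to (stays⇔lattice b) (Equivalence.to back r))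
  (λ lats → Equivalence.from split
    (Equivalence.from (stays⇔lattice a) (proj₁ lats) , Equivalence.from back (Equivalence.from (stays⇔lattice b) (proj₂ lats))))
  where
  up = map +e (toList a)
  split = scanl-++ {P = Region d} move origin up (map -e (List.reverse (toList b)))
  back = retrace origin (toList b) λ i → trans (foldl-+e origin a i)
    (trans (cong (λ c → 0ℤ ℤ.+ ℤ.+ c) (content (toℕ i))) (sym (foldl-+e origin b i)))

-- The correspondence

lattice-cong : ∀ {m w w′} → (∀ {k} → k < m → w k ≡ w′ k) → Lattice m w → Lattice m w′
lattice-cong eq lat {k} k≤m = partition-cong (λ c → count-cong k λ i<k → eq (<-≤-trans i<k k≤m)) (lat k≤m)

module _ {m σ τ σ′ τ′} (D : Diagram m σ τ) (D′ : Diagram m σ′ τ′) (σ≡σ′ : ∀ {i} → i < m → σ i ≡ σ′ i) where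

  recording-cong : ∀ {k} → k < m → rowWord D k ≡ rowWord D′ k
  recording-cong k<m = cong pred (proj₁ (forward-unique D D′ σ≡σ′ (<⇒≤ k<m) ≤-refl) k<m)

  insertion-cong : ∀ {k} → k < m → rowWord (diagram-swap D) k ≡ rowWord (diagram-swap D′) k
  insertion-cong k<m = cong pred (proj₂ (forward-unique D D′ σ≡σ′ ≤-refl (<⇒≤ k<m)) k<m)

columnWord : ∀ {m σ τ} → Diagram m σ τ → ℕ → ℕ
columnWord D = transpose (rowWord D)

column-cong-inverse : ∀ {m σ τ σ′ τ′} (D : Diagram m σ τ) (D′ : Diagram m σ′ τ′) →
  (∀ {k} → k < m → columnWord D k ≡ columnWord D′ k) → ∀ {k} → k < m → rowWord D k ≡ rowWord D′ k
column-cong-inverse D D′ eq k<m = trans (sym (transpose-involutive (rowWord-lattice D) k<m))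
  (trans (transpose-cong eq k<m) (transpose-involutive (rowWord-lattice D′) k<m))

module _ {n r d : ℕ} where

  private
    m : ℕ
    m = n * r

  -- Within a block the permutation descends, so the row of the next box strictly increases and its
  -- column weakly decreases.
  block-decreasing : ∀ {f τ} (D : Diagram m (onCodes f) τ) → BlocksDecrease f →
    (a : Vec (Fin d) m) → (∀ {k} → k < m → word a k ≡ columnWord D k) → BlockDecreasing n r a
  block-decreasing {f} D decreases a a≡ u s s′ s′≡ =
    subst₂ _≤_ (letter s′) (letter s) (subst (λ k → columnWord D k ≤ columnWord D (code (u , s))) (sym next)
      (transpose-descent (rowWord-lattice D) 1+k<m (descent D 1+k<m
        (subst (λ k → onCodes f k < onCodes f (code (u , s))) next
          (subst₂ _<_ (sym (onCodes-code f (u , s′))) (sym (onCodes-code f (u , s)))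
            (decreases u (≤-reflexive (sym s′≡))))))))
    where
    next : code (u , s′) ≡ suc (code (u , s))
    next = code-suc u s′≡
    1+k<m : suc (code (u , s)) < m
    1+k<m = subst (_< m) next (code<n*r (u , s′))
    letter : ∀ s → columnWord D (code (u , s)) ≡ toℕ (lookup a (combine u s))
    letter s = trans (sym (a≡ (code<n*r (u , s)))) (word-lookup a (combine u s))

  module Image {σ τ} (D : Diagram m σ τ) (narrow : width D ≤ d) where

    D⁻¹ = diagram-swap D

    row-bound : count (rowWord D) m 0 ≤ d
    row-bound = ≤-trans (≤-reflexive (sym (rowWord-count D ≤-refl 0))) narrow

    a b : Vec (Fin d) m
    a = vector m (columnWord D) (transpose-bound (rowWord-lattice D) row-bound)
    b = vector m (columnWord D⁻¹) (transpose-bound (rowWord-lattice D⁻¹)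
          (≤-trans (≤-reflexive (sym (rowWords-content D 0))) row-bound))

    a-word : ∀ {k} → k < m → word a k ≡ columnWord D k
    a-word = word-vector m (columnWord D) _

    b-word : ∀ {k} → k < m → word b k ≡ columnWord D⁻¹ k
    b-word = word-vector m (columnWord D⁻¹) _

    walk : Walk d m
    walk = a ∣ b

    content : ∀ c → count (word a) m c ≡ count (word b) m c
    content c = trans (count-cong m a-word) (trans
      (transpose-count-cong (rowWord-lattice D) (rowWord-lattice D⁻¹) (rowWords-content D) c)
      (sym (count-cong m b-word)))

    stays : StaysIn (Region d) (tilde walk)
    stays = Equivalence.from (tilde-stays⇔lattices a b content)
      ( lattice-cong (sym ∘ a-word) (transpose-lattice (rowWord-lattice D))
      , lattice-cong (sym ∘ b-word) (transpose-lattice (rowWord-lattice D⁻¹)) )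

  walk-cong : ∀ {σ τ σ′ τ′} (D : Diagram m σ τ) (D′ : Diagram m σ′ τ′) narrow narrow′ →
    (∀ {i} → i < m → σ i ≡ σ′ i) → Image.walk D narrow ≡ Image.walk D′ narrow′
  walk-cong D D′ narrow narrow′ σ≡σ′ = cong₂ _∣_
    (word-injective I.a I′.a λ k<m → trans (I.a-word k<m)
      (trans (transpose-cong (recording-cong D D′ σ≡σ′) k<m) (sym (I′.a-word k<m))))
    (word-injective I.b I′.b λ k<m → trans (I.b-word k<m)
      (trans (transpose-cong (insertion-cong D D′ σ≡σ′) k<m) (sym (I′.b-word k<m))))
    where
    module I = Image D narrow
    module I′ = Image D′ narrow′

  walk-injective : ∀ {σ τ σ′ τ′} (D : Diagram m σ τ) (D′ : Diagram m σ′ τ′) narrow narrow′ →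
    tilde (Image.walk D narrow) ≡ tilde (Image.walk D′ narrow′) → ∀ {i} → i < m → σ i ≡ σ′ i
  walk-injective D D′ narrow narrow′ eq = permutation-unique D D′
    (column-cong-inverse D D′ λ {k} k<m → trans (sym (I.a-word k<m))
      (trans (cong (λ w → word w k) (cong Walk.a eq)) (I′.a-word k<m)))
    (column-cong-inverse I.D⁻¹ I′.D⁻¹ λ {k} k<m → trans (sym (I.b-word k<m))
      (trans (cong (λ w → word w k) (reverse-injective {xs = I.b} {ys = I′.b} (cong Walk.b eq))) (I′.b-word k<m)))
    where
    module I = Image D narrow
    module I′ = Image D′ narrow′

  module Target (c : Setoid.Carrier (𝒢̅ n r d)) where
    C = ⤖⇒↔ (proj₁ c)
    D = configuration-diagram C
    G = proj₁ (proj₂ c)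
    regular : Regular r G
    regular = proj₁ (proj₁ (proj₂ (proj₂ c)))
    assoc : Associated G (Inverse.to C)
    assoc = proj₂ (proj₂ (proj₂ c))

    narrow : width D ≤ d
    -- The matching drawn from a longest chain has `width D` edges and is bounded by the given
    -- maximum ℓ.
    narrow with (_ , ℓ , (_ , maximal) , ℓ≤d) ← proj₁ (proj₂ (proj₂ c))
              | es , planar , len ← longest-matching C D {G} regular assoc =
      ≤-trans (≤-reflexive (sym len)) (≤-trans (maximal es planar) ℓ≤d)

    open Image D narrow public

    image : Setoid.Carrier (W̃-inRegion n r d)
    image = tilde walk ,
      (walk , (Equivalence.from (closed⇔content a b) content ,
               block-decreasing D (associated-decreases {G = G} assoc) a a-word ,
               block-decreasing D⁻¹ (associated-decreases {G = flip G} (associated-swap {G = G} C assoc)) b b-word) ,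
       refl) ,
      stays

  module Source (a b : Vec (Fin d) m) (content : ∀ c → count (word a) m c ≡ count (word b) m c)
    (a-lattice : Lattice m (word a)) (b-lattice : Lattice m (word b))
    (a-decreasing : BlockDecreasing n r a) (b-decreasing : BlockDecreasing n r b) where

    -- Letters of the walk are columns, labels of the diagram are rows.
    open Backward (transpose (word a)) (transpose (word b))
      (transpose-lattice a-lattice) (transpose-lattice b-lattice)
      (transpose-count-cong a-lattice b-lattice content)
      using (σ; τ; diagram; rowWord-a; rowWord-b)
    open Diagram diagram using (σ<; τ<)

    -- Weakly decreasing columns give strictly increasing rows, by `transpose-ascent` applied to the
    -- column word, whereas an ascent of the permutation would make the rows weakly decrease. Equal
    -- values are excluded by injectivity.
    descends : ∀ {σ τ} (D : Diagram m σ τ) {a : Vec (Fin d) m} → Lattice m (word a) →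
      (∀ {k} → k < m → rowWord D k ≡ transpose (word a) k) →
      ∀ {k} → suc k < m → word a (suc k) ≤ word a k → σ (suc k) < σ k
    descends {σ} {τ} D lat row≡ {k} 1+k<m a≤ with <-cmp (σ (suc k)) (σ k)
    ... | tri< lt _ _ = lt
    ... | tri≈ _ eq _ = contradiction
      (trans (sym (diagram-inverse D 1+k<m)) (trans (cong τ eq) (diagram-inverse D (<⇒≤ 1+k<m)))) λ ()
    ... | tri> _ _ gt = contradiction (transpose-ascent lat 1+k<m a≤)
      (≤⇒≯ (subst₂ _≤_ (row≡ 1+k<m) (row≡ (<⇒≤ 1+k<m)) (ascent D 1+k<m gt)))

    onPairs : ∀ (σ : ℕ → ℕ) → (∀ {i} → i < m → σ i < m) → Fin n × Fin r → Fin n × Fin r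
    onPairs σ σ< x = decode {n} {r} (σ< (code<n*r x))

    code-onPairs : ∀ (σ : ℕ → ℕ) (σ< : ∀ {i} → i < m → σ i < m) x → code (onPairs σ σ< x) ≡ σ (code x)
    code-onPairs σ σ< x = code-decode {n} {r} (σ< (code<n*r x))

    onPairs-inverse : ∀ {σ τ : ℕ → ℕ} (σ< : ∀ {i} → i < m → σ i < m) (τ< : ∀ {i} → i < m → τ i < m) →
      (∀ {i} → i < m → τ (σ i) ≡ i) → ∀ x → onPairs τ τ< (onPairs σ σ< x) ≡ x
    onPairs-inverse {σ} {τ} σ< τ< τσ x = code-injective (begin
      code (onPairs τ τ< (onPairs σ σ< x))  ≡⟨ code-onPairs τ τ< (onPairs σ σ< x) ⟩
      τ (code (onPairs σ σ< x))           ≡⟨ cong τ (code-onPairs σ σ< x) ⟩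
      τ (σ (code x))                    ≡⟨ τσ (code<n*r x) ⟩
      code x                            ∎)
      where open ≡-Reasoning

    C : (Fin n × Fin r) ↔ (Fin n × Fin r)
    C = mk↔ₛ′ (onPairs σ σ<) (onPairs τ τ<)
      (onPairs-inverse τ< σ< (diagram-inverse (diagram-swap diagram)))
      (onPairs-inverse σ< τ< (diagram-inverse diagram))

    onPairs-decreases : ∀ {σ τ} (D : Diagram m σ τ) {a : Vec (Fin d) m} → Lattice m (word a) →
      (∀ {k} → k < m → rowWord D k ≡ transpose (word a) k) → BlockDecreasing n r a →
      BlocksDecrease (onPairs σ (Diagram.σ< D))
    onPairs-decreases {σ} D {a} lat row≡ decreasing = adjacent-decrease (onPairs σ (Diagram.σ< D)) adjacent
      where
      adjacent : ∀ u {s s′} → toℕ s′ ≡ suc (toℕ s) →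
        code (onPairs σ (Diagram.σ< D) (u , s′)) < code (onPairs σ (Diagram.σ< D) (u , s))
      adjacent u {s} {s′} s′≡ = subst₂ _<_
        (trans (cong σ (sym next)) (sym (code-onPairs σ (Diagram.σ< D) (u , s′))))
        (sym (code-onPairs σ (Diagram.σ< D) (u , s)))
        (descends D {a} lat row≡ (subst (_< m) next (code<n*r (u , s′)))
          (subst₂ _≤_ (trans (sym (word-lookup a (combine u s′))) (cong (word a) next))
            (sym (word-lookup a (combine u s))) (decreasing u s s′ s′≡)))
        where
        next : code (u , s′) ≡ suc (code (u , s))
        next = code-suc u s′≡

    to-decreases : BlocksDecrease (Inverse.to C)
    to-decreases = onPairs-decreases diagram {a} a-lattice rowWord-a a-decreasing

    from-decreases : BlocksDecrease (Inverse.from C)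
    from-decreases = onPairs-decreases (diagram-swap diagram) {b} b-lattice rowWord-b b-decreasing

    D = configuration-diagram C

    σ≡ : ∀ {i} → i < m → onCodes (Inverse.to C) i ≡ σ i
    σ≡ = on-codes (λ i → onCodes (Inverse.to C) i ≡ σ i) λ x →
      trans (onCodes-code (Inverse.to C) x) (code-onPairs σ σ< x)

    narrow : width D ≤ d
    narrow = begin
      width D                            ≡⟨ rowWord-count D ≤-refl 0 ⟩
      count (rowWord D) m 0              ≡⟨ count-cong m (λ k<m → trans (recording-cong D diagram σ≡ k<m) (rowWord-a k<m)) ⟩
      count (transpose (word a)) m 0     ≤⟨ transpose-width a-lattice (word-bound a) ⟩
      d                                  ∎
      where open ≤-Reasoning

    source : Setoid.Carrier (𝒢̅ n r d)
    source = ↔⇒⤖ C , multiplicity (Inverse.to C) ,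
      (multiplicity-regular C , width D ,
       width-maximal C D {multiplicity (Inverse.to C)} (multiplicity-regular C) assoc , narrow) ,
      assoc
      where
      assoc : Associated (multiplicity (Inverse.to C)) (Inverse.to C)
      assoc = multiplicity-associated C to-decreases from-decreases

    -- For an arbitrary diagram of the same permutation, since surjectivity asks for the image of
    -- every configuration equal to `source`, and these come with diagrams built forwards.
    image-source : ∀ {σ′ τ′} (D′ : Diagram m σ′ τ′) narrow′ → (∀ {i} → i < m → σ′ i ≡ σ i) →
      Image.walk D′ narrow′ ≡ a ∣ b
    image-source D′ narrow′ σ′≡σ = cong₂ _∣_
      (word-injective I.a a λ k<m → trans (I.a-word k<m) (trans
        (transpose-cong (λ i<m → trans (recording-cong D′ diagram σ′≡σ i<m) (rowWord-a i<m)) k<m)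
        (transpose-involutive a-lattice k<m)))
      (word-injective I.b b λ k<m → trans (I.b-word k<m) (trans
        (transpose-cong (λ i<m → trans (insertion-cong D′ diagram σ′≡σ i<m) (rowWord-b i<m)) k<m)
        (transpose-involutive b-lattice k<m)))
      where module I = Image D′ narrow′

  configuration-cong : ∀ (f g : Fin n × Fin r → Fin n × Fin r) → (∀ x → f x ≡ g x) →
    ∀ {i} → i < m → onCodes f i ≡ onCodes g i
  configuration-cong f g f≡g = on-codes (λ i → onCodes f i ≡ onCodes g i) λ x →
    trans (onCodes-code f x) (trans (cong code (f≡g x)) (sym (onCodes-code g x)))

theorem6 : (n r d : ℕ) → 1 ≤ n → 1 ≤ r → 1 ≤ d →
    Bijection (𝒢̅ n r d) (W̃-inRegion n r d)
theorem6 n r d _ _ _ = record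
  { to        = Target.image
  ; cong      = λ {c} {c′} → image-cong c c′
  ; bijective = (λ {c} {c′} → injective c c′) , surjective
  }
  where
  open Setoid (𝒢̅ n r d) using (Carrier; _≈_)

  image-cong : ∀ c c′ → c ≈ c′ → tilde (Target.walk c) ≡ tilde (Target.walk c′)
  image-cong c c′ c≈c′ = cong tilde (walk-cong {n} {r} {d} T.D T′.D T.narrow T′.narrow
    (configuration-cong {n} {r} {d} (Inverse.to T.C) (Inverse.to T′.C) c≈c′))
    where
    module T = Target c
    module T′ = Target c′

  injective : ∀ c c′ → tilde (Target.walk c) ≡ tilde (Target.walk c′) → c ≈ c′
  injective c c′ eq x = code-injective (trans (sym (onCodes-code (Inverse.to T.C) x))
    (trans (walk-injective {n} {r} {d} T.D T′.D T.narrow T′.narrow eq (code<n*r x)) (onCodes-code (Inverse.to T′.C) x)))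
    where
    module T = Target c
    module T′ = Target c′

  surjective : ∀ (w : Setoid.Carrier (W̃-inRegion n r d)) →
    Σ[ c ∈ Carrier ] (∀ {c′} → c′ ≈ c → tilde (Target.walk c′) ≡ proj₁ w)
  surjective (_ , (a ∣ b , (closed , a-decreasing , b-decreasing) , refl) , stays) =
    S.source , λ {c′} c′≈c → cong tilde (S.image-source (Target.D c′) (Target.narrow c′) λ i<m →
      trans (configuration-cong {n} {r} {d} (Inverse.to (Target.C c′)) (Inverse.to S.C) c′≈c i<m) (S.σ≡ i<m))
    where
    content = Equivalence.to (closed⇔content a b) closed
    lattices : Lattice (n * r) (word a) × Lattice (n * r) (word b)
    lattices = Equivalence.to (tilde-stays⇔lattices a b content) stays
    module S = Source a b content (proj₁ lattices) (proj₂ lattices) a-decreasing b-decreasing
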